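{- Every finite loopless signed multigraph $\Sigma=(G,\sigma)$ satisfies $$\chi'(\Sigma)\leq\Delta(G)+\mu(G).$$
   Context: All graphs are finite and loopless; parallel edges are allowed. $\Delta(G)$ is the maximum degree of $G$ and, for distinct vertices $u,v$, $\mu_G(u,v)$ is the number of edges of $G$ joining $u$ and $v$; $\mu(G)=\max\{\mu_G(u,v):u,v\in V(G),\ u\neq v\}$ (a maximum over an empty set is $0$). A signed multigraph $\Sigma=(G,\sigma)$ consists of a multigraph $G$ and a signature $\sigma:E(G)\to\{1,-1\}$. Each edge $e=uv$ consists of two half-edges: $h_e^u$ at $u$ and $h_e^v$ at $v$. $H(G)$ is the set of all half-edges of $G$, and $H_G(v)$ the set of half-edges at the vertex $v$. For a nonnegative integer $k$, let $M_k=\{ -r,\dots,-1\}\cup\{1,\dots,r\}$ if $k=2r$, and $M_k=\{ -r,\dots,r\}$ (including $0$) if $k=2r+1$. A $k$-edge-coloring of $\Sigma$ is a mapping $\gamma:H(G)\to M_k$ such that the colors of the half-edges in $H_G(v)$ are pairwise distinct for every $v\in V(G)$, and $\gamma(h_e^u)=-\sigma(e)\gamma(h_e^v)$ for every edge $e=uv\in E(G)$. The chromatic index $\chi'(\Sigma)$ is the least nonnegative integer $k$ for which $\Sigma$ has a $k$-edge-coloring. -}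

module Defs where

open import Data.Empty using (⊥-elim)
open import Data.Fin.Base using (Fin; toℕ; fromℕ<; opposite; combine; remQuot; finToFun; funToFin)
open import Data.Fin.Patterns using (0F; 1F)
import Data.Fin.Properties as Fin
open import Data.Integer.Base using (ℤ; +_; -[1+_]; +[1+_]; -_; ∣_∣; _◃_; 0ℤ; 1ℤ; -1ℤ; +≤+; -≤-; -≤+)
import Data.Integer.Base as ℤ
import Data.Integer.Properties as ℤ
open import Data.List.Base using (List; map; filter; cartesianProduct; allFin)
open import Data.List.Extrema.Nat using (max)
open import Data.Nat.Base using (ℕ; zero; suc; _+_; _*_; _^_; _≤_; _<_; z≤n; s≤s)
import Data.Nat.Properties as ℕ
open import Data.Product.Base using (∃; _×_; _,_; proj₁; proj₂; uncurry)
open import Data.Product.Properties using (≡-dec)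
open import Data.Sign.Base using (Sign)
open import Data.Sum.Base using (_⊎_; inj₁; inj₂)
import Data.Vec.Base as Vec
open import Level using (Level)
open import Relation.Binary.PropositionalEquality
open import Relation.Nullary using (¬_; Dec; yes; no; ¬?)
open import Relation.Nullary.Decidable using (map′; _×-dec_; _⊎-dec_; _→-dec_)
open import Relation.Unary using (Pred; Decidable)

private
  variable
    p : Level
    n : ℕ

-- The two half-edges of an edge e are the pairs (e , 0F) and (e , 1F); the
-- half-edge (e , i) is the one at the vertex  end e i.  Which end is numbered
-- 0F is immaterial, so edges are undirected.
record Multigraph : Set where
  field
    #V       : ℕ
    #E       : ℕ
    end      : Fin #E → Fin 2 → Fin #V
    loopless : ∀ e → end e 0F ≢ end e 1F

  Vertex : Set
  Vertex = Fin #V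

  Edge : Set
  Edge = Fin #E

  HalfEdge : Set
  HalfEdge = Edge × Fin 2

  at : HalfEdge → Vertex
  at (e , i) = end e i

  Incident : Vertex → Edge → Set
  Incident v e = end e 0F ≡ v ⊎ end e 1F ≡ v

  incident? : ∀ v → Decidable (Incident v)
  incident? v e = (end e 0F Fin.≟ v) ⊎-dec (end e 1F Fin.≟ v)

  Joins : Vertex → Vertex → Edge → Set
  Joins u v e = (end e 0F ≡ u × end e 1F ≡ v) ⊎ (end e 0F ≡ v × end e 1F ≡ u)

  joins? : ∀ u v → Decidable (Joins u v)
  joins? u v e = ((end e 0F Fin.≟ u) ×-dec (end e 1F Fin.≟ v))
           ⊎-dec ((end e 0F Fin.≟ v) ×-dec (end e 1F Fin.≟ u))

  degree : Vertex → ℕ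
  degree v = Vec.count (incident? v) (Vec.allFin #E)

  multiplicity : Vertex → Vertex → ℕ
  multiplicity u v = Vec.count (joins? u v) (Vec.allFin #E)

  distinctPairs : List (Vertex × Vertex)
  distinctPairs = filter (λ (u , v) → ¬? (u Fin.≟ v)) (cartesianProduct (allFin #V) (allFin #V))

  Δ : ℕ
  Δ = max 0 (map degree (allFin #V))

  μ : ℕ
  μ = max 0 (map (uncurry multiplicity) distinctPairs)

record SignedMultigraph : Set where
  field
    G : Multigraph
    σ : Multigraph.Edge G → Sign

  open Multigraph G public

-- The colour set M_k = {-r,…,-1} ∪ {1,…,r} for k = 2r and {-r,…,r} for k = 2r+1.
_∈M_ : ℤ → ℕ → Set
z ∈M k =
    (∃ λ r → k ≡ 2 * r × ((- (+ r) ℤ.≤ z × z ℤ.≤ -1ℤ) ⊎ (1ℤ ℤ.≤ z × z ℤ.≤ + r)))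
  ⊎ (∃ λ r → k ≡ 2 * r + 1 × (- (+ r) ℤ.≤ z × z ℤ.≤ + r))

record IsEdgeColoring (Σ : SignedMultigraph) (k : ℕ) (γ : SignedMultigraph.HalfEdge Σ → ℤ) : Set where
  open SignedMultigraph Σ
  field
    inPalette : ∀ h → γ h ∈M k
    proper    : ∀ h h′ → at h ≡ at h′ → h ≢ h′ → γ h ≢ γ h′
    -- On Fin 2, opposite swaps 0F and 1F, and  σ e ◃ 1  is the integer ±1.
    signed    : ∀ e i → γ (e , i) ≡ - ((σ e ◃ 1) ℤ.* γ (e , opposite i))

EdgeColorable : SignedMultigraph → ℕ → Set
EdgeColorable Σ k = ∃ (IsEdgeColoring Σ k)

IsLeast : Pred ℕ p → Pred ℕ p
IsLeast P k = P k × (∀ j → P j → k ≤ j)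

least : {P : Pred ℕ p} → Decidable P → ∃ P → ∃ (IsLeast P)
least {P = P} P? (b , Pb) with search (suc b)
  where
  search : ∀ n → ∃ (IsLeast P) ⊎ (∀ j → j < n → ¬ P j)
  search zero    = inj₂ λ _ ()
  search (suc n) with search n
  ... | inj₁ found = inj₁ found
  ... | inj₂ none with P? n
  ...   | yes Pn = inj₁ (n , Pn , λ j Pj → ℕ.≮⇒≥ (λ j<n → none j j<n Pj))
  ...   | no ¬Pn = inj₂ λ j j<1+n Pj → case-≤ j (ℕ.m<1+n⇒m<n∨m≡n j<1+n) Pj
    where
    case-≤ : ∀ j → j < n ⊎ j ≡ n → ¬ P j
    case-≤ j (inj₁ j<n)  = none j j<n
    case-≤ j (inj₂ refl) = ¬Pn
... | inj₁ found = found
... | inj₂ none  = ⊥-elim (none b ℕ.≤-refl Pb)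

∈M? : ∀ z k → Dec (z ∈M k)
∈M? z k = bounded even? (λ { r refl → ℕ.m≤m+n r _ }) ⊎-dec
          bounded odd? (λ { r refl → ℕ.≤-trans (ℕ.m≤m+n r _) (ℕ.m≤m+n _ 1) })
  where
  even? : Decidable (λ r → (- (+ r) ℤ.≤ z × z ℤ.≤ -1ℤ) ⊎ (1ℤ ℤ.≤ z × z ℤ.≤ + r))
  even? r = ((- (+ r) ℤ.≤? z) ×-dec (z ℤ.≤? -1ℤ)) ⊎-dec ((1ℤ ℤ.≤? z) ×-dec (z ℤ.≤? + r))

  odd? : Decidable (λ r → - (+ r) ℤ.≤ z × z ℤ.≤ + r)
  odd? r = (- (+ r) ℤ.≤? z) ×-dec (z ℤ.≤? + r)

  bounded : {f : ℕ → ℕ} {P : Pred ℕ p} → Decidable P → (∀ r → k ≡ f r → r ≤ k) →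
            Dec (∃ λ r → k ≡ f r × P r)
  bounded {f = f} P? bound =
    map′ (λ (r , _ , q) → r , q) (λ (r , k≡ , q) → r , s≤s (bound r k≡) , k≡ , q)
         (ℕ.anyUpTo? (λ r → (k ℕ.≟ f r) ×-dec P? r) (suc k))

∣∣-bound : ∀ r z → - (+ r) ℤ.≤ z → z ℤ.≤ + r → ∣ z ∣ ≤ r
∣∣-bound r       (+ a)    _         (+≤+ a≤r) = a≤r
∣∣-bound (suc r) -[1+ a ] (-≤- a≤r) _         = s≤s a≤r

∈M⇒∣∣≤ : ∀ {z k} → z ∈M k → ∣ z ∣ ≤ k
∈M⇒∣∣≤ {z} (inj₁ (r , refl , inj₁ (lo , hi))) =
  ℕ.≤-trans (∣∣-bound r z lo (ℤ.≤-trans hi -≤+)) (ℕ.m≤m+n r _)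
∈M⇒∣∣≤ {z} (inj₁ (r , refl , inj₂ (lo , hi))) =
  ℕ.≤-trans (∣∣-bound r z (ℤ.≤-trans (ℤ.neg-≤-pos {r} {1}) lo) hi) (ℕ.m≤m+n r _)
∈M⇒∣∣≤ {z} (inj₂ (r , refl , lo , hi)) =
  ℕ.≤-trans (∣∣-bound r z lo hi) (ℕ.≤-trans (ℕ.m≤m+n r _) (ℕ.m≤m+n _ 1))

module _ (Σ : SignedMultigraph) where
  open SignedMultigraph Σ

  allHalfEdges? : {P : Pred HalfEdge p} → Decidable P → Dec (∀ h → P h)
  allHalfEdges? P? = map′ (λ f (e , i) → f e i) (λ f e i → f (e , i))
                          (Fin.all? λ e → Fin.all? λ i → P? (e , i))

  isEdgeColoring? : ∀ k γ → Dec (IsEdgeColoring Σ k γ)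
  isEdgeColoring? k γ =
    map′ (λ (a , b , c) → record { inPalette = a ; proper = b ; signed = c })
         (λ c → let open IsEdgeColoring c in inPalette , proper , signed)
         (allHalfEdges? (λ h → ∈M? (γ h) k)
           ×-dec allHalfEdges? (λ h → allHalfEdges? λ h′ →
                   (at h Fin.≟ at h′) →-dec (¬? (≡-dec Fin._≟_ Fin._≟_ h h′)
                                        →-dec ¬? (γ h ℤ.≟ γ h′)))
           ×-dec Fin.all? (λ e → Fin.all? λ i → γ (e , i) ℤ.≟ - ((σ e ◃ 1) ℤ.* γ (e , opposite i))))

  isEdgeColoring-resp-≗ : ∀ {k γ δ} → γ ≗ δ → IsEdgeColoring Σ k γ → IsEdgeColoring Σ k δ
  isEdgeColoring-resp-≗ {k} {γ} {δ} γ≗δ c = record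
    { inPalette = λ h → subst (_∈M k) (γ≗δ h) (inPalette h)
    ; proper    = λ h h′ q h≢h′ r → proper h h′ q h≢h′ (trans (γ≗δ h) (trans r (sym (γ≗δ h′))))
    ; signed    = λ e i → trans (sym (γ≗δ (e , i)))
                    (trans (signed e i) (cong (λ z → - ((σ e ◃ 1) ℤ.* z)) (γ≗δ (e , opposite i))))
    }
    where open IsEdgeColoring c

  -- All integers of absolute value at most k are coded by Fin (2 * suc k), so
  -- there are finitely many candidates for a k-edge-colouring.
  private
    signedValue : ∀ {b} → Fin 2 × Fin b → ℤ
    signedValue (0F , a) = + toℕ a
    signedValue (1F , a) = - (+ toℕ a)

    decode : ∀ k → Fin (2 * suc k) → ℤ
    decode k c = signedValue (remQuot {2} (suc k) c)

    decode-surjective : ∀ k z → ∣ z ∣ ≤ k → ∃ λ c → decode k c ≡ z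
    decode-surjective k (+ a) a≤k =
      combine {2} 0F (fromℕ< (s≤s a≤k)) ,
      trans (cong signedValue (Fin.remQuot-combine {2} {suc k} 0F (fromℕ< (s≤s a≤k))))
            (cong +_ (Fin.toℕ-fromℕ< (s≤s a≤k)))
    decode-surjective k -[1+ a ] a<k =
      combine {2} 1F (fromℕ< (s≤s a<k)) ,
      trans (cong signedValue (Fin.remQuot-combine {2} {suc k} 1F (fromℕ< (s≤s a<k))))
            (cong (λ x → - (+ x)) (Fin.toℕ-fromℕ< (s≤s a<k)))

    candidate : ∀ k → Fin ((2 * suc k) ^ (#E * 2)) → HalfEdge → ℤ
    candidate k x (e , i) = decode k (finToFun x (combine e i))

    candidate-surjective : ∀ k (γ : HalfEdge → ℤ) → (∀ h → ∣ γ h ∣ ≤ k) → ∃ λ x → γ ≗ candidate k x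
    candidate-surjective k γ bound = funToFin f , eq
      where
      code : HalfEdge → Fin (2 * suc k)
      code h = proj₁ (decode-surjective k (γ h) (bound h))

      f : Fin (#E * 2) → Fin (2 * suc k)
      f j = code (remQuot 2 j)

      eq : γ ≗ candidate k (funToFin f)
      eq (e , i) = sym (trans (cong (decode k)
                          (trans (Fin.finToFun-funToFin f (combine e i))
                                 (cong code (Fin.remQuot-combine e i))))
                        (proj₂ (decode-surjective k (γ (e , i)) (bound (e , i)))))

  edgeColorable? : Decidable (EdgeColorable Σ)
  edgeColorable? k =
    map′ (λ (x , c) → candidate k x , c)
         (λ (γ , c) → let x , γ≗ = candidate-surjective k γ (λ h → ∈M⇒∣∣≤ (IsEdgeColoring.inPalette c h))
                      in x , isEdgeColoring-resp-≗ γ≗ c)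
         (Fin.any? λ x → isEdgeColoring? k (candidate k x))

  -- Giving the half-edges of the j-th edge the colours ±j uses 2|E| colours.
  edgeColorable-2#E : EdgeColorable Σ (2 * #E)
  edgeColorable-2#E = γ , record
    { inPalette = λ (e , i) → inj₁ (#E , refl , palette (γ (e , i)) (toℕ e) (∣γ∣ e i) (Fin.toℕ<n e))
    ; proper    = λ { (e , i) (e′ , i′) q h≢h′ r → h≢h′ (sameHalf e e′ i i′ q (sameEdge e e′ i i′ r)) }
    ; signed    = λ { e 0F → signed₀ (σ e) (+ suc (toℕ e)) ; e 1F → refl }
    }
    where
    γ : HalfEdge → ℤ
    γ (e , 0F) = + suc (toℕ e)
    γ (e , 1F) = - ((σ e ◃ 1) ℤ.* (+ suc (toℕ e)))

    signed₀ : ∀ s z → z ≡ - ((s ◃ 1) ℤ.* (- ((s ◃ 1) ℤ.* z)))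
    signed₀ Sign.+ z rewrite ℤ.*-identityˡ z | ℤ.*-identityˡ (- z) = sym (ℤ.neg-involutive z)
    signed₀ Sign.- z rewrite ℤ.-1*i≡-i z | ℤ.neg-involutive z | ℤ.-1*i≡-i z = sym (ℤ.neg-involutive z)

    ∣-s*z∣ : ∀ s z → ∣ - ((s ◃ 1) ℤ.* z) ∣ ≡ ∣ z ∣
    ∣-s*z∣ Sign.+ z rewrite ℤ.*-identityˡ z = ℤ.∣-i∣≡∣i∣ z
    ∣-s*z∣ Sign.- z rewrite ℤ.-1*i≡-i z | ℤ.neg-involutive z = refl

    ∣γ∣ : ∀ e i → ∣ γ (e , i) ∣ ≡ suc (toℕ e)
    ∣γ∣ e 0F = refl
    ∣γ∣ e 1F = ∣-s*z∣ (σ e) (+ suc (toℕ e))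

    palette : ∀ {r} z a → ∣ z ∣ ≡ suc a → a < r →
              (- (+ r) ℤ.≤ z × z ℤ.≤ -1ℤ) ⊎ (1ℤ ℤ.≤ z × z ℤ.≤ + r)
    palette +[1+ a ] a refl a<r       = inj₂ (+≤+ (s≤s z≤n) , +≤+ a<r)
    palette -[1+ a ] a refl (s≤s a≤r) = inj₁ (-≤- a≤r , -≤- z≤n)

    sameEdge : ∀ e e′ i i′ → γ (e , i) ≡ γ (e′ , i′) → e ≡ e′
    sameEdge e e′ i i′ r =
      Fin.toℕ-injective (ℕ.suc-injective (trans (sym (∣γ∣ e i)) (trans (cong ∣_∣ r) (∣γ∣ e′ i′))))

    sameHalf : ∀ e e′ i i′ → end e i ≡ end e′ i′ → e ≡ e′ → (e , i) ≡ (e′ , i′)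
    sameHalf e .e 0F 0F q refl = refl
    sameHalf e .e 0F 1F q refl = ⊥-elim (loopless e q)
    sameHalf e .e 1F 0F q refl = ⊥-elim (loopless e (sym q))
    sameHalf e .e 1F 1F q refl = refl

  chromaticIndex : ∃ (IsLeast (EdgeColorable Σ))
  chromaticIndex = least edgeColorable? (2 * #E , edgeColorable-2#E)

χ′ : SignedMultigraph → ℕ
χ′ Σ = proj₁ (chromaticIndex Σ)

{-# OPTIONS --safe #-}
module Submission where

open import Defs
open import Data.Nat.Base using (_+_; _≤_)

open import Data.Bool.Base using (true; false; if_then_else_)
open import Data.Empty using (⊥-elim)
open import Data.Fin.Base using (Fin; toℕ) renaming (opposite to flip)
open import Data.Fin.Patterns using (0F; 1F)
import Data.Fin.Properties as Fin
open import Data.Integer.Base using (ℤ; -_; _◃_; 0ℤ; 1ℤ; -1ℤ; +≤+; -≤-; -≤+)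
import Data.Integer.Base as ℤ
import Data.Integer.Properties as ℤ
open import Data.List.Base using (List; []; _∷_; _++_; map; length; filter; lookup; allFin; cartesianProduct)
import Data.List.Base as List
import Data.List.Extrema.Nat as Extrema
import Data.List.Membership.DecPropositional as DecMembership
open import Data.List.Membership.Propositional using (_∈_; _∉_; find; lose)
open import Data.List.Membership.Propositional.Properties
  using (∈-++⁺ˡ; ∈-++⁺ʳ; ∈-++⁻; ∈-∃++; ∈-filter⁺; ∈-filter⁻; ∈-map⁺; ∈-map⁻; ∈-allFin; ∈-lookup;
         ∈-cartesianProduct⁺; ∈-cartesianProduct⁻)
open import Data.List.Properties using (length-++; length-map; map-∘; map-tabulate; tabulate-lookup; length-tabulate)
open import Data.List.Relation.Binary.Permutation.Propositional using (_↭_; ↭-refl; ↭-sym; ↭-trans; prep; ↭⇒↭ₛ)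
import Data.List.Relation.Binary.Permutation.Propositional as ↭
import Data.List.Relation.Binary.Permutation.Propositional.Properties as ↭
import Data.List.Relation.Binary.Permutation.Setoid.Properties as ↭ₛ
import Data.List.Relation.Unary.All as All
open import Data.List.Relation.Unary.AllPairs using ([]; _∷_)
open import Data.List.Relation.Unary.Any using (Any; here; there)
import Data.List.Relation.Unary.Any as Any
open import Data.List.Relation.Unary.Any.Properties using (lookup-index)
open import Data.List.Relation.Unary.Unique.Propositional using (Unique)
open import Data.List.Relation.Unary.Unique.Propositional.Properties using (Unique[x∷xs]⇒x∉xs)
import Data.List.Relation.Unary.Unique.Propositional.Properties as Unique
open import Data.Maybe.Base using (Maybe; just; nothing)
open import Data.Maybe.Properties using (just-injective)
import Data.Maybe.Properties as Maybe
open import Data.Nat.Base using (ℕ; zero; suc; _*_; _∸_; _<_; z≤n; s≤s)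
open import Data.Nat.ListAction using (sum)
open import Data.Nat.ListAction.Properties using (sum-↭)
import Data.Nat.Properties as ℕ
open import Algebra.Properties.CommutativeSemigroup ℕ.+-commutativeSemigroup using (interchange)
open import Data.Product.Base using (∃; ∃₂; _×_; _,_; proj₁; proj₂)
open import Data.Product.Properties using (≡-dec)
open import Data.Sign.Base using (Sign; opposite)
import Data.Sign.Base as Sign
import Data.Sign.Properties as Sign
open import Data.Sum.Base using (_⊎_; inj₁; inj₂)
import Data.Sum.Base as Sum
import Data.Sum.Properties as Sum
open import Data.Unit.Base using (⊤; tt)
import Data.Vec.Base as Vec
open import Function.Base using (_∘_)
open import Level using (Level; 0ℓ)
open import Relation.Binary.Definitions using (DecidableEquality)
open import Relation.Binary.PropositionalEquality
open import Relation.Nullary using (¬_; Dec; yes; no; ¬?; does)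
open import Relation.Nullary.Decidable using (map′; _×-dec_; _⊎-dec_; decidable-stable)
open import Relation.Unary using (Pred; Decidable)

-- Vertices are inserted one at a time.  When u is inserted, every edge from u to a neighbour w is
-- offered two of the colours missing at w, transported along the edge to u; the edges at u can be
-- coloured as soon as the offers have a system of distinct representatives.  A Kempe swap that
-- commutes with negation, started at an offered colour, changes that offer and at most one other,
-- so what remains is a game on the multiset of offers.  There are 2n colours ±m and at most 2n
-- edges, hence 4n offers at most.  A colour ±m offered at most twice can be eliminated: either an
-- edge takes it, or two edges offered it merge into one.  Swaps balance the number of offers over
-- the magnitudes until both colours of some magnitude can be eliminated without losing the bound.
--
-- With an odd number of colours, 0 is given to a maximal matching M.  The vertices missed by M are
-- independent and are inserted last, so all neighbours met during an insertion are M-saturated.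

-- The edge condition transports a colour by a sign, so a Kempe swap can cross an edge only if it
-- commutes with negation: exchanging `m` with `m′` also exchanges `-m` with `-m′`. The two colours
-- of a magnitude therefore cannot be balanced freely, and the cases depend on how its offers split
-- between them.
--
-- Deleting a magnitude lowers the allowance of `2 * n` tokens by two, so it must dispose of two
-- tokens, or of fewer when the bound has slack. A colour disposes of a token if it is offered once
-- or twice. The stubborn split is 3+1: `a` is offered too often, and settling the only offer of
-- `-a` need not reduce it. There a second magnitude has to help.
--
-- The second offer changed by a swap is not under control, but distinct offers have distinct chain
-- partners; among enough starting points one has a partner outside any given short list.
--
-- Room for two offers per edge comes from `Δ + μ`: at a neighbour `w` the edges to `u` are counted
-- twice, which adds at most `μ` to the degree of `w`. With an odd palette a matching edge coloured
-- 0 lowers the degree of its ends by one, so the same count fits into one colour less.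

private
  variable
    l l′ : Level
    r : ℕ
    A B E : Set
    P : Set l
    Q : Set l′
    f g : A → ℕ
    x y : A
    xs ys : List A

-- Indicators and sums over lists

𝟙 : Dec P → ℕ
𝟙 P? = if does P? then 1 else 0

𝟙-yes : (P? : Dec P) → P → 𝟙 P? ≡ 1
𝟙-yes (yes _) _ = refl
𝟙-yes (no ¬p) p = ⊥-elim (¬p p)

𝟙-no : (P? : Dec P) → ¬ P → 𝟙 P? ≡ 0
𝟙-no (yes p) ¬p = ⊥-elim (¬p p)
𝟙-no (no _)  _  = refl

𝟙-mono : (P? : Dec P) (Q? : Dec Q) → (P → Q) → 𝟙 P? ≤ 𝟙 Q?
𝟙-mono (no _)  _  _   = z≤n
𝟙-mono (yes p) Q? P⇒Q = ℕ.≤-reflexive (sym (𝟙-yes Q? (P⇒Q p)))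

𝟙≤1 : (P? : Dec P) → 𝟙 P? ≤ 1
𝟙≤1 (yes _) = s≤s z≤n
𝟙≤1 (no _)  = z≤n

𝟙-pos : (P? : Dec P) → 1 ≤ 𝟙 P? → P
𝟙-pos (yes p) _ = p

∑ : List A → (A → ℕ) → ℕ
∑ xs f = sum (map f xs)

∑-cong : ∀ xs → (∀ {x : A} → x ∈ xs → f x ≡ g x) → ∑ xs f ≡ ∑ xs g
∑-cong []       _   = refl
∑-cong (x ∷ xs) f≡g = cong₂ _+_ (f≡g (here refl)) (∑-cong xs (f≡g ∘ there))

∑-mono : ∀ xs → (∀ {x : A} → x ∈ xs → f x ≤ g x) → ∑ xs f ≤ ∑ xs g
∑-mono []       _   = z≤n
∑-mono (x ∷ xs) f≤g = ℕ.+-mono-≤ (f≤g (here refl)) (∑-mono xs (f≤g ∘ there))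

∑-mono-< : (∀ {x : A} → x ∈ xs → f x ≤ g x) → y ∈ xs → f y < g y → ∑ xs f < ∑ xs g
∑-mono-< f≤g (here refl) fy<gy = ℕ.+-mono-<-≤ fy<gy (∑-mono _ (f≤g ∘ there))
∑-mono-< f≤g (there y∈)  fy<gy = ℕ.+-mono-≤-< (f≤g (here refl)) (∑-mono-< (f≤g ∘ there) y∈ fy<gy)

∑-+ : ∀ (xs : List A) → ∑ xs (λ x → f x + g x) ≡ ∑ xs f + ∑ xs g
∑-+ []       = refl
∑-+ {f = f} {g = g} (x ∷ xs) =
  trans (cong (f x + g x +_) (∑-+ xs)) (interchange (f x) (g x) _ _)

∑-++ : ∀ (xs : List A) → ∑ (xs ++ ys) f ≡ ∑ xs f + ∑ ys f
∑-++ []       = refl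
∑-++ {f = f} (x ∷ xs) = trans (cong (f x +_) (∑-++ xs)) (sym (ℕ.+-assoc (f x) _ _))

∑-const : ∀ (xs : List A) c → ∑ xs (λ _ → c) ≡ length xs * c
∑-const []       c = refl
∑-const (x ∷ xs) c = cong (c +_) (∑-const xs c)

∑-zero : ∀ (xs : List A) → (∀ {x} → x ∈ xs → f x ≡ 0) → ∑ xs f ≡ 0
∑-zero []       _   = refl
∑-zero (x ∷ xs) f≡0 = cong₂ _+_ (f≡0 (here refl)) (∑-zero xs (f≡0 ∘ there))

∑-swap : ∀ (xs : List A) (ys : List B) (f : A → B → ℕ) →
         ∑ xs (λ x → ∑ ys (f x)) ≡ ∑ ys (λ y → ∑ xs (λ x → f x y))
∑-swap []       ys f = sym (∑-zero ys λ _ → refl)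
∑-swap (x ∷ xs) ys f = trans (cong (∑ ys (f x) +_) (∑-swap xs ys f)) (sym (∑-+ ys))

∑-↭ : xs ↭ ys → ∑ xs f ≡ ∑ ys f
∑-↭ p = sum-↭ (↭.map⁺ _ p)

∑-member : x ∈ xs → f x ≤ ∑ xs f
∑-member (here refl) = ℕ.m≤m+n _ _
∑-member (there x∈)  = ℕ.≤-trans (∑-member x∈) (ℕ.m≤n+m _ _)

∑-pos : ∀ (xs : List A) → 1 ≤ ∑ xs f → ∃ λ x → x ∈ xs × 1 ≤ f x
∑-pos {f = f} (x ∷ xs) 1≤ with f x in eq
... | suc n = x , here refl , subst (1 ≤_) (sym eq) (s≤s z≤n)
... | zero  = let y , y∈ , 1≤fy = ∑-pos xs 1≤ in y , there y∈ , 1≤fy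

∑-filter : ∀ {P : Pred A l} (P? : Decidable P) xs →
           ∑ (filter P? xs) f ≡ ∑ xs (λ x → 𝟙 (P? x) * f x)
∑-filter P? []       = refl
∑-filter {f = f} P? (x ∷ xs) with does (P? x)
... | true  = cong₂ _+_ (sym (ℕ.+-identityʳ (f x))) (∑-filter P? xs)
... | false = ∑-filter P? xs

length-filter≡∑ : ∀ {P : Pred A l} (P? : Decidable P) xs →
                  length (filter P? xs) ≡ ∑ xs (λ x → 𝟙 (P? x))
length-filter≡∑ P? []       = refl
length-filter≡∑ P? (x ∷ xs) with does (P? x)
... | true  = cong suc (length-filter≡∑ P? xs)
... | false = length-filter≡∑ P? xs

∑-𝟙≟ : (_≟_ : DecidableEquality A) → Unique xs → x ∈ xs → ∑ xs (λ y → 𝟙 (x ≟ y)) ≡ 1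
∑-𝟙≟ _≟_ (x∉ ∷ _) (here {xs = xs} refl) =
  cong₂ _+_ (𝟙-yes (_ ≟ _) refl) (∑-zero xs λ y∈ → 𝟙-no (_ ≟ _) (All.lookup x∉ y∈))
∑-𝟙≟ _≟_ (y∉ ∷ uniq) (there x∈) =
  cong₂ _+_ (𝟙-no (_ ≟ _) (λ x≡y → All.lookup y∉ x∈ (sym x≡y))) (∑-𝟙≟ _≟_ uniq x∈)

-- Permutations and duplicate-free lists

unique-↭ : xs ↭ ys → Unique xs → Unique ys
unique-↭ p = ↭ₛ.Unique-resp-↭ (setoid _) (↭⇒↭ₛ p)

extract : x ∈ xs → ∃ λ ys → xs ↭ x ∷ ys
extract x∈ with ys , zs , refl ← ∈-∃++ x∈ = ys ++ zs , ↭.shift _ ys zs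

∈-tail : y ∈ x ∷ xs → y ≢ x → y ∈ xs
∈-tail (here y≡x) y≢x = ⊥-elim (y≢x y≡x)
∈-tail (there y∈) _   = y∈

unique-length : Unique xs → (∀ {x : A} → x ∈ xs → x ∈ ys) → length xs ≤ length ys
unique-length []           _  = z≤n
unique-length {xs = x ∷ xs} uniq@(_ ∷ uniq′) xs⊆ys with zs , ys↭ ← extract (xs⊆ys (here refl)) =
  subst (suc (length xs) ≤_) (sym (↭.↭-length ys↭))
    (s≤s (unique-length uniq′ λ z∈ → ∈-tail (↭.∈-resp-↭ ys↭ (xs⊆ys (there z∈)))
                                            λ { refl → Unique[x∷xs]⇒x∉xs uniq z∈ }))

-- Signed colours and swaps that commute with negation

-- (m , s) stands for the non-zero colour s(m + 1).
Colour : ℕ → Set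
Colour r = Fin r × Sign

mag : Colour r → Fin r
mag = proj₁

_≟ᶜ_ : DecidableEquality (Colour r)
_≟ᶜ_ = ≡-dec Fin._≟_ Sign._≟_

infixr 8 _·_
_·_ : Sign → Colour r → Colour r
s · (m , t) = m , s Sign.* t

neg : Colour r → Colour r
neg (m , s) = m , opposite s

·-involutive : ∀ s (c : Colour r) → s · s · c ≡ c
·-involutive Sign.+ _            = refl
·-involutive Sign.- (_ , Sign.+) = refl
·-involutive Sign.- (_ , Sign.-) = refl

neg-involutive : (c : Colour r) → neg (neg c) ≡ c
neg-involutive (_ , s) = cong (_ ,_) (Sign.opposite-involutive s)

neg-≢ : (c : Colour r) → neg c ≢ c
neg-≢ (_ , s) eq = Sign.s≢opposite[s] s (sym (cong proj₂ eq))

same-mag : (c d : Colour r) → mag c ≡ mag d → c ≡ d ⊎ c ≡ neg d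
same-mag (m , Sign.+) (.m , Sign.+) refl = inj₁ refl
same-mag (m , Sign.+) (.m , Sign.-) refl = inj₂ refl
same-mag (m , Sign.-) (.m , Sign.+) refl = inj₂ refl
same-mag (m , Sign.-) (.m , Sign.-) refl = inj₁ refl

-- Equivariance preserves the edge condition when both halves of an edge are recoloured by `τ`;
-- involutivity makes Kempe chains reversible.
record IsSwap (τ : Colour r → Colour r) : Set where
  field
    involutive  : ∀ c → τ (τ c) ≡ c
    equivariant : ∀ s c → τ (s · c) ≡ s · τ c

  injective : ∀ {c d} → τ c ≡ τ d → c ≡ d
  injective {c} {d} eq = trans (sym (involutive c)) (trans (cong τ eq) (involutive d))

-- Exchanges (m , s) with (m′ , q s); for m ≡ m′ and q = - it negates the colours of magnitude m.
swap : Fin r → Fin r → Sign → Colour r → Colour r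
swap m m′ q (x , s) with x Fin.≟ m | x Fin.≟ m′
... | yes _ | _     = m′ , q Sign.* s
... | no _  | yes _ = m  , q Sign.* s
... | no _  | no _  = x  , s

module _ (m m′ : Fin r) (q : Sign) where

  swap-from : ∀ s → swap m m′ q (m , s) ≡ (m′ , q Sign.* s)
  swap-from s with m Fin.≟ m
  ... | yes _  = refl
  ... | no m≢m = ⊥-elim (m≢m refl)

  swap-to : ∀ s → swap m m′ q (m′ , s) ≡ (m , q Sign.* s)
  swap-to s with m′ Fin.≟ m | m′ Fin.≟ m′
  ... | yes refl | _      = refl
  ... | no _     | yes _  = refl
  ... | no _     | no m≢m = ⊥-elim (m≢m refl)

  swap-other : ∀ c → mag c ≢ m → mag c ≢ m′ → swap m m′ q c ≡ c
  swap-other (x , s) x≢m x≢m′ with x Fin.≟ m | x Fin.≟ m′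
  ... | yes x≡m | _        = ⊥-elim (x≢m x≡m)
  ... | no _    | yes x≡m′ = ⊥-elim (x≢m′ x≡m′)
  ... | no _    | no _     = refl

  swap-isSwap : IsSwap (swap m m′ q)
  swap-isSwap = record { involutive = inv ; equivariant = equi }
    where
    cancel : ∀ q s → q Sign.* (q Sign.* s) ≡ s
    cancel q s = cong proj₂ (·-involutive q (m , s))

    inv : ∀ c → swap m m′ q (swap m m′ q c) ≡ c
    inv (x , s) with x Fin.≟ m | x Fin.≟ m′
    ... | yes refl | _        = trans (swap-to _) (cong (x ,_) (cancel q s))
    ... | no _     | yes refl = trans (swap-from _) (cong (x ,_) (cancel q s))
    ... | no x≢m   | no x≢m′  = swap-other (x , s) x≢m x≢m′

    comm : ∀ q t s → q Sign.* (t Sign.* s) ≡ t Sign.* (q Sign.* s)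
    comm q t s = trans (sym (Sign.*-assoc q t s)) (trans (cong (Sign._* s) (Sign.*-comm q t)) (Sign.*-assoc t q s))

    equi : ∀ t c → swap m m′ q (t · c) ≡ t · swap m m′ q c
    equi t (x , s) with x Fin.≟ m | x Fin.≟ m′
    ... | yes _ | _     = cong (m′ ,_) (comm q t s)
    ... | no _  | yes _ = cong (m ,_) (comm q t s)
    ... | no _  | no _  = refl

-- Tokens and systems of distinct representatives

-- A token is an edge at the vertex being inserted; its two ends carry the two colours offered to it.
ends : List (E × E) → List E
ends []             = []
ends ((x , y) ∷ Ts) = x ∷ y ∷ ends Ts

length-ends : (Ts : List (E × E)) → length (ends Ts) ≡ 2 * length Ts
length-ends []       = refl
length-ends (_ ∷ Ts) = trans (cong (suc ∘ suc) (length-ends Ts)) (sym (ℕ.*-suc 2 (length Ts)))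

data Split {E : Set} : List (E × E) → E → E → List (E × E) → Set where
  here  : ∀ {x y Ts} → Split ((x , y) ∷ Ts) x y Ts
  here′ : ∀ {x y Ts} → Split ((y , x) ∷ Ts) x y Ts
  there : ∀ {t x y Ts Ts′} → Split Ts x y Ts′ → Split (t ∷ Ts) x y (t ∷ Ts′)

split : ∀ {x : E} Ts → x ∈ ends Ts → ∃₂ λ y Ts′ → Split Ts x y Ts′
split ((x , y) ∷ Ts) (here refl)         = _ , _ , here
split ((x , y) ∷ Ts) (there (here refl)) = _ , _ , here′
split ((x , y) ∷ Ts) (there (there x∈))  = let _ , _ , s = split Ts x∈ in _ , _ , there s

split-↭ : ∀ {x y : E} {Ts Ts′} → Split Ts x y Ts′ → ends Ts ↭ x ∷ y ∷ ends Ts′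
split-↭ here      = ↭-refl
split-↭ here′     = ↭.swap _ _ ↭-refl
split-↭ {x = x} {y} (there {t = u , v} {Ts′ = Ts′} s) =
  ↭-trans (prep u (prep v (split-↭ s))) (↭.shifts (u ∷ v ∷ []) (x ∷ y ∷ []) {ends Ts′})

split-length : ∀ {x y : E} {Ts Ts′} → Split Ts x y Ts′ → length Ts ≡ suc (length Ts′)
split-length here      = refl
split-length here′     = refl
split-length (there s) = cong suc (split-length s)

split-∈ : ∀ {x y u v : E} {Ts Ts′} → Split Ts x y Ts′ → (u , v) ∈ Ts →
          (u , v) ∈ Ts′ ⊎ (u ≡ x × v ≡ y) ⊎ (u ≡ y × v ≡ x)
split-∈ here      (here refl) = inj₂ (inj₁ (refl , refl))
split-∈ here      (there t∈)  = inj₁ t∈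
split-∈ here′     (here refl) = inj₂ (inj₂ (refl , refl))
split-∈ here′     (there t∈)  = inj₁ t∈
split-∈ (there s) (here refl) = inj₁ (here refl)
split-∈ (there s) (there t∈)  = Sum.map₁ there (split-∈ s t∈)

-- A set of ends rather than a choice function on tokens: a merged token has ends from two tokens,
-- so a choice for it has no single token to carry back to.
record SDR (ℓ : E → Colour r) (Ts : List (E × E)) : Set where
  field
    chosen    : List E
    chosen⊆   : ∀ {x} → x ∈ chosen → x ∈ ends Ts
    hits      : ∀ {x y} → (x , y) ∈ Ts → x ∈ chosen ⊎ y ∈ chosen
    injective : ∀ {x y} → x ∈ chosen → y ∈ chosen → ℓ x ≡ ℓ y → x ≡ y

-- Counting offers by colour and by magnitude

abstract
  δ : Colour r → Colour r → ℕ
  δ d c = 𝟙 (d ≟ᶜ c)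

  δ-≡ : {d c : Colour r} → d ≡ c → δ d c ≡ 1
  δ-≡ = 𝟙-yes (_ ≟ᶜ _)

  δ-≢ : {d c : Colour r} → d ≢ c → δ d c ≡ 0
  δ-≢ = 𝟙-no (_ ≟ᶜ _)

  δ≤1 : (d c : Colour r) → δ d c ≤ 1
  δ≤1 d c = 𝟙≤1 (d ≟ᶜ c)

  δ-pos : {d c : Colour r} → 1 ≤ δ d c → d ≡ c
  δ-pos = 𝟙-pos (_ ≟ᶜ _)

  length-filter≡cnt : ∀ (ℓ : E → Colour r) c es →
                      length (filter (λ z → ℓ z ≟ᶜ c) es) ≡ ∑ es (λ z → δ (ℓ z) c)
  length-filter≡cnt ℓ c = length-filter≡∑ (λ z → ℓ z ≟ᶜ c)

cnt : (E → Colour r) → Colour r → List E → ℕ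
cnt ℓ c es = ∑ es (λ z → δ (ℓ z) c)

weight : (E → Colour r) → Fin r → List E → ℕ
weight ℓ m es = ∑ es (λ z → 𝟙 (mag (ℓ z) Fin.≟ m))

weight-split : ∀ (ℓ : E → Colour r) c es → weight ℓ (mag c) es ≡ cnt ℓ c es + cnt ℓ (neg c) es
weight-split ℓ c es = trans (∑-cong es λ {z} _ → eq (ℓ z) (mag (ℓ z) Fin.≟ mag c)) (∑-+ es)
  where
  eq : ∀ d (m? : Dec (mag d ≡ mag c)) → 𝟙 m? ≡ δ d c + δ d (neg c)
  eq d (no ≢m) = sym (cong₂ _+_ (δ-≢ λ { refl → ≢m refl }) (δ-≢ λ { refl → ≢m refl }))
  eq d (yes ≡m) with same-mag d c ≡m
  ... | inj₁ refl = sym (cong₂ _+_ (δ-≡ {d = d} refl) (δ-≢ (neg-≢ d ∘ sym)))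
  ... | inj₂ refl = sym (cong₂ _+_ (δ-≢ (neg-≢ c)) (δ-≡ {d = d} refl))

cnt≡0 : ∀ (ℓ : E → Colour r) {c es z} → cnt ℓ c es ≡ 0 → z ∈ es → ℓ z ≢ c
cnt≡0 ℓ {c} {es} {z} none z∈ ℓz≡c with
  subst (1 ≤_) none (ℕ.≤-trans (ℕ.≤-reflexive (sym (δ-≡ ℓz≡c))) (∑-member {f = λ z → δ (ℓ z) c} z∈))
... | ()

cnt-pos : ∀ {ℓ : E → Colour r} {c} es → 1 ≤ cnt ℓ c es → ∃ λ z → z ∈ es × ℓ z ≡ c
cnt-pos es 1≤ = let z , z∈ , 1≤δ = ∑-pos es 1≤ in z , z∈ , δ-pos 1≤δ

-- Eliminating a colour

-- The reduction of a colour c borne by at most two ends: a token with an end coloured c may be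
-- given c and forgotten; if two tokens bear c, one of them takes c and the remaining ends of the
-- two form a new token.
record Reduction (ℓ : E → Colour r) (c : Colour r) (Ts Ts′ : List (E × E)) : Set where
  field
    lost  : List E
    ends↭ : ends Ts ↭ lost ++ ends Ts′
    gone  : cnt ℓ c (ends Ts′) ≡ 0
    -- A later labelling `ℓ′` is allowed because the rest of the game may still swap; only the set
    -- of bearers of `c` has to stay the same.
    lift  : ∀ {ℓ′} → (∀ z → ℓ z ≡ c → ℓ′ z ≡ c) → (∀ z → ℓ z ≢ c → ℓ′ z ≢ c) →
            SDR ℓ′ Ts′ → SDR ℓ′ Ts

  remaining : ∀ {z} → z ∈ ends Ts′ → z ∈ ends Ts
  remaining = ↭.∈-resp-↭ (↭-sym ends↭) ∘ ∈-++⁺ʳ lost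

  cnt-split : ∀ d → cnt ℓ d (ends Ts) ≡ cnt ℓ d lost + cnt ℓ d (ends Ts′)
  cnt-split d = trans (∑-↭ ends↭) (∑-++ lost)

  unique : Unique (ends Ts) → Unique (ends Ts′)
  unique = drop⁺ ∘ unique-↭ ends↭
    where
    drop⁺ : ∀ {xs ys : List E} → Unique (xs ++ ys) → Unique ys
    drop⁺ {[]}     uniq       = uniq
    drop⁺ {_ ∷ xs} (_ ∷ uniq) = drop⁺ {xs} uniq

module _ {ℓ : E → Colour r} {c : Colour r} where

  reduce-none : ∀ {Ts} → cnt ℓ c (ends Ts) ≡ 0 → Reduction ℓ c Ts Ts
  reduce-none none = record { lost = [] ; ends↭ = ↭-refl ; gone = none ; lift = λ _ _ sdr → sdr }

  private
    cons-injective : ∀ {ℓ′ : E → Colour r} {x cs} → ℓ′ x ≡ c → (∀ {z} → z ∈ cs → ℓ′ z ≢ c) →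
                     (∀ {y z} → y ∈ cs → z ∈ cs → ℓ′ y ≡ ℓ′ z → y ≡ z) →
                     ∀ {y z} → y ∈ x ∷ cs → z ∈ x ∷ cs → ℓ′ y ≡ ℓ′ z → y ≡ z
    cons-injective x≡c ≢c inj (here refl) (here refl) _  = refl
    cons-injective x≡c ≢c inj (here refl) (there z∈)  eq = ⊥-elim (≢c z∈ (trans (sym eq) x≡c))
    cons-injective x≡c ≢c inj (there y∈)  (here refl) eq = ⊥-elim (≢c y∈ (trans eq x≡c))
    cons-injective x≡c ≢c inj (there y∈)  (there z∈)  eq = inj y∈ z∈ eq

  -- The token is settled by `x`. No remaining end bears `c`, so the choices made for the other
  -- tokens cannot collide with it.
  reduce-leaf : ∀ {Ts x y Ts′} → Split Ts x y Ts′ → ℓ x ≡ c → cnt ℓ c (ends Ts′) ≡ 0 → Reduction ℓ c Ts Ts′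
  reduce-leaf {Ts} {x} {y} {Ts′} s x≡c none = record
    { lost  = x ∷ y ∷ []
    ; ends↭ = split-↭ s
    ; gone  = none
    ; lift  = λ keeps avoids sdr → let open SDR sdr in record
      { chosen    = x ∷ chosen
      ; chosen⊆   = λ { (here refl) → ∈Ts (here refl) ; (there z∈) → ∈Ts (there (there (chosen⊆ z∈))) }
      ; hits      = λ t∈ → hit sdr (split-∈ s t∈)
      ; injective = cons-injective (keeps x x≡c) (λ z∈ → avoids _ (cnt≡0 ℓ none (chosen⊆ z∈))) injective
      }
    }
    where
    ∈Ts : ∀ {z} → z ∈ x ∷ y ∷ ends Ts′ → z ∈ ends Ts
    ∈Ts = ↭.∈-resp-↭ (↭-sym (split-↭ s))

    hit : ∀ {ℓ′ : E → Colour r} {u v} (sdr : SDR ℓ′ Ts′) →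
          (u , v) ∈ Ts′ ⊎ (u ≡ x × v ≡ y) ⊎ (u ≡ y × v ≡ x) →
          u ∈ x ∷ SDR.chosen sdr ⊎ v ∈ x ∷ SDR.chosen sdr
    hit sdr (inj₁ t∈)                 = Sum.map there there (SDR.hits sdr t∈)
    hit sdr (inj₂ (inj₁ (refl , _))) = inj₁ (here refl)
    hit sdr (inj₂ (inj₂ (_ , refl))) = inj₂ (here refl)

  -- Whichever of `y` and `y′` is chosen for the merged token settles its own original token; the
  -- other original token then takes its end coloured `c`. Hence `c` is used only once.
  reduce-merge : ∀ {Ts x y Ts₁ x′ y′ Ts₂} → Split Ts x y Ts₁ → Split Ts₁ x′ y′ Ts₂ →
                 ℓ x ≡ c → ℓ x′ ≡ c → cnt ℓ c (ends ((y , y′) ∷ Ts₂)) ≡ 0 → Reduction ℓ c Ts ((y , y′) ∷ Ts₂)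
  reduce-merge {Ts} {x} {y} {Ts₁} {x′} {y′} {Ts₂} s s′ x≡c x′≡c none = record
    { lost  = x ∷ x′ ∷ []
    ; ends↭ = ends↭
    ; gone  = none
    ; lift  = λ keeps avoids sdr → let open SDR sdr
                                       ≢c = λ {z} z∈ → avoids z (cnt≡0 ℓ none (chosen⊆ z∈)) in
      case-hit (hits (here refl))
        (λ y∈ → record
          { chosen    = x′ ∷ chosen
          ; chosen⊆   = λ { (here refl) → ∈Ts (there (here refl)) ; (there z∈) → ∈Ts (there (there (chosen⊆ z∈))) }
          ; hits      = λ t∈ → hit′ sdr y∈ (split-∈ s t∈)
          ; injective = cons-injective (keeps x′ x′≡c) ≢c injective })
        (λ y′∈ → record
          { chosen    = x ∷ chosen
          ; chosen⊆   = λ { (here refl) → ∈Ts (here refl) ; (there z∈) → ∈Ts (there (there (chosen⊆ z∈))) }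
          ; hits      = λ t∈ → hit sdr y′∈ (split-∈ s t∈)
          ; injective = cons-injective (keeps x x≡c) ≢c injective })
    }
    where
    ends↭ : ends Ts ↭ x ∷ x′ ∷ y ∷ y′ ∷ ends Ts₂
    ends↭ = ↭-trans (split-↭ s) (↭-trans (prep x (prep y (split-↭ s′))) (prep x (↭.swap y x′ ↭-refl)))

    ∈Ts : ∀ {z} → z ∈ x ∷ x′ ∷ y ∷ y′ ∷ ends Ts₂ → z ∈ ends Ts
    ∈Ts = ↭.∈-resp-↭ (↭-sym ends↭)

    case-hit : ∀ {A B C : Set} → A ⊎ B → (A → C) → (B → C) → C
    case-hit a⊎b f g = Sum.[ f , g ] a⊎b

    module _ {ℓ′ : E → Colour r} (sdr : SDR ℓ′ ((y , y′) ∷ Ts₂)) where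
      open SDR sdr

      hit : y′ ∈ chosen → ∀ {u v} → (u , v) ∈ Ts₁ ⊎ (u ≡ x × v ≡ y) ⊎ (u ≡ y × v ≡ x) →
            u ∈ x ∷ chosen ⊎ v ∈ x ∷ chosen
      hit y′∈ (inj₂ (inj₁ (refl , _))) = inj₁ (here refl)
      hit y′∈ (inj₂ (inj₂ (_ , refl))) = inj₂ (here refl)
      hit y′∈ (inj₁ t∈) with split-∈ s′ t∈
      ... | inj₁ t∈′               = Sum.map there there (hits (there t∈′))
      ... | inj₂ (inj₁ (_ , refl)) = inj₂ (there y′∈)
      ... | inj₂ (inj₂ (refl , _)) = inj₁ (there y′∈)

      hit′ : y ∈ chosen → ∀ {u v} → (u , v) ∈ Ts₁ ⊎ (u ≡ x × v ≡ y) ⊎ (u ≡ y × v ≡ x) →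
             u ∈ x′ ∷ chosen ⊎ v ∈ x′ ∷ chosen
      hit′ y∈ (inj₂ (inj₁ (_ , refl))) = inj₂ (there y∈)
      hit′ y∈ (inj₂ (inj₂ (refl , _))) = inj₁ (there y∈)
      hit′ y∈ (inj₁ t∈) with split-∈ s′ t∈
      ... | inj₁ t∈′               = Sum.map there there (hits (there t∈′))
      ... | inj₂ (inj₁ (refl , _)) = inj₁ (here refl)
      ... | inj₂ (inj₂ (_ , refl)) = inj₂ (here refl)

  -- A merge loses two bearers of `c`, a leaf loses one bearer and its mate. So at most one end of
  -- any other colour disappears, which later guarantees a surviving bearer of the opposite colour.
  reduce : ∀ Ts → 1 ≤ cnt ℓ c (ends Ts) → cnt ℓ c (ends Ts) ≤ 2 →
           ∃ λ Ts′ → Reduction ℓ c Ts Ts′ × length Ts ≡ suc (length Ts′) ×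
                     (∀ d → d ≢ c → cnt ℓ d (ends Ts) ≤ suc (cnt ℓ d (ends Ts′)))
  reduce Ts 1≤ ≤2 with cnt-pos (ends Ts) 1≤
  ... | x , x∈ , x≡c with split Ts x∈
  ...   | y , Ts₁ , s with ends-split c
    where
    ends-split : ∀ d → cnt ℓ d (ends Ts) ≡ δ (ℓ x) d + (δ (ℓ y) d + cnt ℓ d (ends Ts₁))
    ends-split d = ∑-↭ (split-↭ s)
  ...     | total = go (cnt ℓ c (ends Ts₁) ℕ.≟ 0)
    where
    lost-x : ∀ d → d ≢ c → cnt ℓ d (ends Ts) ≡ δ (ℓ y) d + cnt ℓ d (ends Ts₁)
    lost-x d d≢c = trans (∑-↭ (split-↭ s))
      (cong (_+ (δ (ℓ y) d + cnt ℓ d (ends Ts₁))) (δ-≢ λ x≡d → d≢c (trans (sym x≡d) x≡c)))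

    remaining≤1 : δ (ℓ y) c + cnt ℓ c (ends Ts₁) ≤ 1
    remaining≤1 = ℕ.≤-pred (subst (_≤ 2) (trans total (cong (_+ _) (δ-≡ x≡c))) ≤2)

    go : Dec (cnt ℓ c (ends Ts₁) ≡ 0) → _
    -- This includes a token both of whose ends bear `c`.
    go (yes none) = Ts₁ , reduce-leaf s x≡c none , split-length s , λ d d≢c →
      subst (_≤ suc (cnt ℓ d (ends Ts₁))) (sym (lost-x d d≢c)) (ℕ.+-monoˡ-≤ _ (δ≤1 (ℓ y) d))
    go (no some) with cnt-pos (ends Ts₁) (ℕ.n≢0⇒n>0 some)
    ... | x′ , x′∈ , x′≡c with split Ts₁ x′∈
    ...   | y′ , Ts₂ , s′ =
      (y , y′) ∷ Ts₂ , reduce-merge s s′ x≡c x′≡c none ,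
      trans (split-length s) (cong suc (split-length s′)) , λ d d≢c →
      ℕ.m≤n⇒m≤1+n (ℕ.≤-reflexive (trans (lost-x d d≢c) (cong (δ (ℓ y) d +_)
        (trans (∑-↭ (split-↭ s′)) (cong (_+ (δ (ℓ y′) d + cnt ℓ d (ends Ts₂)))
          (δ-≢ λ x≡d → d≢c (trans (sym x≡d) x′≡c)))))))
      where
      none : δ (ℓ y) c + (δ (ℓ y′) c + cnt ℓ c (ends Ts₂)) ≡ 0
      none = ℕ.n≤0⇒n≡0 (ℕ.≤-pred (subst (_≤ 1) (trans (cong (δ (ℓ y) c +_)
        (trans (∑-↭ (split-↭ s′)) (cong (_+ _) (δ-≡ x′≡c)))) (ℕ.+-suc _ _)) remaining≤1))

-- The effect of a Kempe swap on the offers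

record KempeSwap {E State : Set} (lab : State → E → Colour r) (S : State) (τ : Colour r → Colour r) : Set where
  field
    partner           : E → Maybe E
    partner-injective : ∀ {x y z} → partner x ≡ just z → partner y ≡ just z → x ≡ y
    result            : E → State
    swapped           : ∀ x z → z ≡ x ⊎ partner x ≡ just z → lab (result x) z ≡ τ (lab S z)
    fixed             : ∀ x z → z ≢ x → partner x ≢ just z → lab (result x) z ≡ lab S z

-- `B` lists the ends that the partner has been made to avoid. `single` also covers a chain whose
-- other end is no longer in `es`: ends discarded by reductions may still be relabelled.
data Effect {E : Set} (ℓ ℓ′ : E → Colour r) (τ : Colour r → Colour r) (B es : List E) (x : E) : Set where
  single : ∀ rest → es ↭ x ∷ rest → ℓ′ x ≡ τ (ℓ x) → (∀ {z} → z ∈ rest → ℓ′ z ≡ ℓ z) →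
           Effect ℓ ℓ′ τ B es x
  double : ∀ y rest → y ∉ B → es ↭ x ∷ y ∷ rest → ℓ′ x ≡ τ (ℓ x) → ℓ′ y ≡ τ (ℓ y) →
           (∀ {z} → z ∈ rest → ℓ′ z ≡ ℓ z) → Effect ℓ ℓ′ τ B es x

-- The game: choosing where to start a swap

module Game {E State : Set} (_≟ᴱ_ : DecidableEquality E) (lab : State → E → Colour r)
            (kempe : ∀ S {τ} → IsSwap τ → KempeSwap lab S τ) where

  open DecMembership _≟ᴱ_ using (_∈?_)
  open DecMembership (Fin._≟_ {r}) using () renaming (_∈?_ to _∈ᶠ?_)

  -- Quantified over all ends and not only those in play, since discarded ends may already hold the
  -- colour assigned to a settled token.
  record Confined (S S′ : State) (Act : List (Fin r)) : Set where
    field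
      inside  : ∀ z → mag (lab S z) ∈ Act → mag (lab S′ z) ∈ Act
      outside : ∀ z → mag (lab S z) ∉ Act → lab S′ z ≡ lab S z

  confined-refl : ∀ {S Act} → Confined S S Act
  confined-refl = record { inside = λ _ m∈ → m∈ ; outside = λ _ _ → refl }

  confined-trans : ∀ {S S′ S″ Act} → Confined S S′ Act → Confined S′ S″ Act → Confined S S″ Act
  confined-trans {S} {S′} c c′ = record
    { inside  = λ z → C′.inside z ∘ C.inside z
    ; outside = λ z m∉ → trans (C′.outside z (subst (λ d → mag d ∉ _) (sym (C.outside z m∉)) m∉)) (C.outside z m∉)
    }
    where
    module C = Confined c
    module C′ = Confined c′

  confined-mono : ∀ {S S′ Act Act′} → (∀ {m} → m ∈ Act′ → m ∈ Act) → Confined S S′ Act′ → Confined S S′ Act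
  confined-mono {S} {S′} {Act} {Act′} ⊆Act c = record
    { inside  = λ z m∈ → in-case z m∈ (mag (lab S z) ∈ᶠ? Act′)
    ; outside = λ z m∉ → outside z (m∉ ∘ ⊆Act)
    }
    where
    open Confined c
    in-case : ∀ z → mag (lab S z) ∈ Act → Dec (mag (lab S z) ∈ Act′) → mag (lab S′ z) ∈ Act
    in-case z _  (yes m∈) = ⊆Act (inside z m∈)
    in-case z m∈ (no m∉)  = subst (λ d → mag d ∈ Act) (sym (outside z m∉)) m∈

  module _ {S : State} {τ : Colour r → Colour r} (k : KempeSwap lab S τ) where
    open KempeSwap k

    swapped? : ∀ x z → lab (result x) z ≡ τ (lab S z) ⊎ lab (result x) z ≡ lab S z
    swapped? x z with z ≟ᴱ x | Maybe.≡-dec _≟ᴱ_ (partner x) (just z)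
    ... | yes z≡x | _     = inj₁ (swapped x z (inj₁ z≡x))
    ... | no _    | yes p = inj₁ (swapped x z (inj₂ p))
    ... | no z≢x  | no ¬p = inj₂ (fixed x z z≢x ¬p)

    effect : ∀ {es B x} → Unique es → x ∈ es → (∀ {y} → y ∈ B → partner x ≢ just y) →
             Effect (lab S) (lab (result x)) τ B es x
    effect {es} {B} {x} uniq x∈ p∉B = go (partner x) refl
      where
      rest = proj₁ (extract x∈)
      es↭ : es ↭ x ∷ rest
      es↭ = proj₂ (extract x∈)
      x∉rest : ∀ {z} → z ∈ rest → z ≢ x
      x∉rest z∈ refl = Unique[x∷xs]⇒x∉xs (unique-↭ es↭ uniq) z∈
      x-swapped = swapped x x (inj₁ refl)

      go : ∀ p → partner x ≡ p → Effect (lab S) (lab (result x)) τ B es x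
      go nothing p≡ = single rest es↭ x-swapped λ z∈ →
        fixed x _ (x∉rest z∈) (λ p≡just → case-nothing (trans (sym p≡) p≡just))
        where
        case-nothing : ∀ {z : E} → nothing ≢ just z
        case-nothing ()
      go (just y) p≡ with y ∈? rest
      ... | no y∉ = single rest es↭ x-swapped λ z∈ →
        fixed x _ (x∉rest z∈) (λ p≡just → y∉ (subst (_∈ rest) (just-injective (trans (sym p≡just) p≡)) z∈))
      ... | yes y∈ with rest′ , rest↭ ← extract y∈ =
        double y rest′ (λ y∈B → p∉B y∈B p≡) (↭-trans es↭ (prep x rest↭)) x-swapped (swapped x y (inj₂ p≡))
          λ z∈ → fixed x _ (x∉rest (↭.∈-resp-↭ (↭-sym rest↭) (there z∈)))
            λ p≡just → y∉rest′ rest↭ (subst (_∈ rest′) (just-injective (trans (sym p≡just) p≡)) z∈)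
        where
        tail : ∀ {xs : List E} → Unique (x ∷ xs) → Unique xs
        tail (_ ∷ u) = u
        y∉rest′ : ∀ {rest′} → rest ↭ y ∷ rest′ → y ∉ rest′
        y∉rest′ rest↭ = Unique[x∷xs]⇒x∉xs (unique-↭ rest↭ (tail (unique-↭ es↭ uniq)))

    -- Pigeonhole for the injective partial map `partner`: each element of `B` is the partner of at
    -- most one element of `A`.
    avoid : ∀ (A B : List E) → Unique A → length B < length A →
            ∃ λ x → x ∈ A × (∀ {y} → y ∈ B → partner x ≢ just y)
    avoid (x ∷ A) B uniq@(_ ∷ uniqA) (s≤s B≤A) with Any.any? (λ y → Maybe.≡-dec _≟ᴱ_ (partner x) (just y)) B
    ... | no none = x , here refl , λ y∈ p≡ → none (Any.map (λ { refl → p≡ }) y∈)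
    ... | yes some with y , y∈ , p≡ ← find some
          with B′ , B↭ ← extract y∈
          with x′ , x′∈ , p∉ ← avoid A B′ uniqA (subst (_≤ length A) (↭.↭-length B↭) B≤A) =
      x′ , there x′∈ , λ z∈ p′≡ → case (↭.∈-resp-↭ B↭ z∈) p′≡
      where
      case : ∀ {z} → z ∈ y ∷ B′ → partner x′ ≢ just z
      case (here refl) p′≡ = Unique[x∷xs]⇒x∉xs uniq (subst (_∈ A) (partner-injective p′≡ p≡) x′∈)
      case (there z∈)  p′≡ = p∉ z∈ p′≡

  swap-confined : ∀ {S S′ Act m m′} q → m ∈ Act → m′ ∈ Act →
                  (∀ z → lab S′ z ≡ swap m m′ q (lab S z) ⊎ lab S′ z ≡ lab S z) → Confined S S′ Act
  swap-confined {S} {S′} {Act} {m} {m′} q m∈ m′∈ alt = record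
    { inside  = λ z → Sum.[ (λ eq z∈ → subst (λ d → mag d ∈ Act) (sym eq) (swap-in (lab S z) z∈))
                          , (λ eq → subst (λ d → mag d ∈ Act) (sym eq)) ] (alt z)
    ; outside = λ z m∉ → Sum.[ (λ eq → trans eq (swap-out (lab S z) m∉)) , (λ eq → eq) ] (alt z)
    }
    where
    swap-in : ∀ d → mag d ∈ Act → mag (swap m m′ q d) ∈ Act
    swap-in (n , s) n∈ with n Fin.≟ m | n Fin.≟ m′
    ... | yes _ | _     = m′∈
    ... | no _  | yes _ = m∈
    ... | no _  | no _  = n∈

    swap-out : ∀ d → mag d ∉ Act → swap m m′ q d ≡ d
    swap-out d d∉ = swap-other m m′ q d (λ { refl → d∉ m∈ }) (λ { refl → d∉ m′∈ })

  step : ∀ S {Act es m m′} q → Unique es → m ∈ Act → m′ ∈ Act →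
         ∀ A B → Unique A → (∀ {x} → x ∈ A → x ∈ es) → length B < length A →
         ∃₂ λ x S′ → x ∈ A × Confined S S′ Act × Effect (lab S) (lab S′) (swap m m′ q) B es x
  step S q uniq m∈ m′∈ A B uniqA A⊆es B<A =
    let k = kempe S (swap-isSwap _ _ q)
        x , x∈ , p∉B = avoid k A B uniqA B<A
    in x , KempeSwap.result k x , x∈ , swap-confined q m∈ m′∈ (swapped? k x) , effect k uniq (A⊆es x∈) p∉B

  cnt-agree : ∀ {ℓ ℓ′ : E → Colour r} {rest} → (∀ {z} → z ∈ rest → ℓ′ z ≡ ℓ z) → ∀ c → cnt ℓ′ c rest ≡ cnt ℓ c rest
  cnt-agree {rest = rest} agree c = ∑-cong rest λ z∈ → cong (λ d → δ d c) (agree z∈)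

  -- There are more bearers of `m′` than of `m`, so the swap can start at a bearer of `m′` whose
  -- partner does not bear `m`. Then no offer leaves `m`, and at most two leave `m′`.
  raise : ∀ S {Act es m m′} → Unique es → m ∈ Act → m′ ∈ Act →
          weight (lab S) m es < weight (lab S) m′ es →
          ∃ λ S′ → Confined S S′ Act ×
                   weight (lab S) m es < weight (lab S′) m es ×
                   weight (lab S) m′ es ≤ 2 + weight (lab S′) m′ es ×
                   (∀ k → k ≢ m → k ≢ m′ → weight (lab S) k es ≤ weight (lab S′) k es)
  raise S {Act} {es} {m} {m′} uniq m∈ m′∈ lighter
    with step S Sign.+ uniq m∈ m′∈ (bearers m′) (bearers m) (Unique.filter⁺ (λ z → mag (lab S z) Fin.≟ m′) uniq)
              (proj₁ ∘ ∈-filter⁻ (λ z → mag (lab S z) Fin.≟ m′))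
              (subst₂ _<_ (sym (length-bearers m)) (sym (length-bearers m′)) lighter)
    where
    bearers : Fin r → List E
    bearers k = filter (λ z → mag (lab S z) Fin.≟ k) es
    length-bearers : ∀ k → length (bearers k) ≡ weight (lab S) k es
    length-bearers k = length-filter≡∑ (λ z → mag (lab S z) Fin.≟ k) es
  ... | x , S′ , x∈ , conf , eff = S′ , conf , result eff
    where
    ℓ = lab S
    ℓ′ = lab S′

    x≡m′ : mag (ℓ x) ≡ m′
    x≡m′ = proj₂ (∈-filter⁻ (λ z → mag (ℓ z) Fin.≟ m′) {xs = es} x∈)

    m≢m′ : m ≢ m′
    m≢m′ refl = ℕ.<-irrefl refl lighter

    mag-swap : ∀ d → mag d ≡ m′ → mag (swap m m′ Sign.+ d) ≡ m
    mag-swap (_ , s) refl = cong mag (swap-to m m′ Sign.+ s)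

    χ : Fin r → Colour r → ℕ
    χ k d = 𝟙 (mag d Fin.≟ k)

    χ-yes : ∀ {k d} → mag d ≡ k → χ k d ≡ 1
    χ-yes = 𝟙-yes (_ Fin.≟ _)

    χ-no : ∀ {k d} → mag d ≢ k → χ k d ≡ 0
    χ-no = 𝟙-no (_ Fin.≟ _)

    χ≤1 : ∀ k d → χ k d ≤ 1
    χ≤1 k d = 𝟙≤1 (mag d Fin.≟ k)

    combine : ∀ mv rest → es ↭ mv ++ rest → (∀ {z} → z ∈ rest → ℓ′ z ≡ ℓ z) →
              weight ℓ m mv < weight ℓ′ m mv → weight ℓ m′ mv ≤ 2 →
              (∀ k → k ≢ m → k ≢ m′ → weight ℓ k mv ≤ weight ℓ′ k mv) →
              weight ℓ m es < weight ℓ′ m es × weight ℓ m′ es ≤ 2 + weight ℓ′ m′ es ×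
              (∀ k → k ≢ m → k ≢ m′ → weight ℓ k es ≤ weight ℓ′ k es)
    combine mv rest es↭ agree up down other =
      subst₂ _<_ (sym (before m)) (sym (after m)) (ℕ.+-monoˡ-< _ up) ,
      subst₂ _≤_ (sym (before m′)) (cong (2 +_) (sym (after m′))) (ℕ.+-mono-≤ down (ℕ.m≤n+m _ (weight ℓ′ m′ mv))) ,
      λ k k≢m k≢m′ → subst₂ _≤_ (sym (before k)) (sym (after k)) (ℕ.+-monoˡ-≤ _ (other k k≢m k≢m′))
      where
      before : ∀ k → weight ℓ k es ≡ weight ℓ k mv + weight ℓ k rest
      before k = trans (∑-↭ es↭) (∑-++ mv)
      after : ∀ k → weight ℓ′ k es ≡ weight ℓ′ k mv + weight ℓ k rest
      after k = trans (trans (∑-↭ es↭) (∑-++ mv))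
                      (cong (weight ℓ′ k mv +_) (∑-cong rest λ z∈ → cong (χ k) (agree z∈)))

    result : Effect ℓ ℓ′ (swap m m′ Sign.+) (filter (λ z → mag (ℓ z) Fin.≟ m) es) es x →
             weight ℓ m es < weight ℓ′ m es × weight ℓ m′ es ≤ 2 + weight ℓ′ m′ es ×
             (∀ k → k ≢ m → k ≢ m′ → weight ℓ k es ≤ weight ℓ′ k es)
    result (single rest es↭ x′≡ agree) = combine (x ∷ []) rest es↭ agree
      (subst₂ _<_ (sym (cong (_+ 0) (χ-no {d = ℓ x} x≢m))) (sym (cong (_+ 0) (χ-yes {d = ℓ′ x} x′≡m))) (s≤s z≤n))
      (ℕ.m≤n⇒m≤1+n (subst (_≤ 1) (sym (ℕ.+-identityʳ _)) (χ≤1 m′ (ℓ x))))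
      λ k _ k≢m′ → ℕ.≤-trans (ℕ.≤-reflexive (cong (_+ 0) (χ-no {d = ℓ x} λ x≡k → k≢m′ (trans (sym x≡k) x≡m′)))) z≤n
      where
      x≢m : mag (ℓ x) ≢ m
      x≢m x≡m = m≢m′ (trans (sym x≡m) x≡m′)
      x′≡m : mag (ℓ′ x) ≡ m
      x′≡m = trans (cong mag x′≡) (mag-swap (ℓ x) x≡m′)
    result (double y rest y∉ es↭ x′≡ y′≡ agree) = combine (x ∷ y ∷ []) rest es↭ agree
      (subst₂ _<_ (sym (cong₂ (λ a b → a + (b + 0)) (χ-no {d = ℓ x} x≢m) (χ-no {d = ℓ y} y≢m)))
                  (sym (cong (_+ (χ m (ℓ′ y) + 0)) (χ-yes {d = ℓ′ x} x′≡m))) (s≤s z≤n))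
      (ℕ.+-mono-≤ (χ≤1 m′ (ℓ x)) (subst (_≤ 1) (sym (ℕ.+-identityʳ _)) (χ≤1 m′ (ℓ y))))
      λ k k≢m k≢m′ → ℕ.+-mono-≤ {χ k (ℓ x)} {χ k (ℓ′ x)}
        (ℕ.≤-trans (ℕ.≤-reflexive (χ-no {d = ℓ x} λ x≡k → k≢m′ (trans (sym x≡k) x≡m′))) z≤n)
        (ℕ.+-monoˡ-≤ 0 (𝟙-mono (mag (ℓ y) Fin.≟ k) (mag (ℓ′ y) Fin.≟ k) λ y≡k →
          trans (cong mag (trans y′≡ (swap-other m m′ Sign.+ (ℓ y) (λ y≡m → k≢m (trans (sym y≡k) y≡m))
                                                                   (λ y≡m′ → k≢m′ (trans (sym y≡k) y≡m′))))) y≡k))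
      where
      x≢m : mag (ℓ x) ≢ m
      x≢m x≡m = m≢m′ (trans (sym x≡m) x≡m′)
      x′≡m : mag (ℓ′ x) ≡ m
      x′≡m = trans (cong mag x′≡) (mag-swap (ℓ x) x≡m′)
      y≢m : mag (ℓ y) ≢ m
      y≢m y≡m = y∉ (∈-filter⁺ (λ z → mag (ℓ z) Fin.≟ m) (↭.∈-resp-↭ (↭-sym es↭) (there (here refl))) y≡m)

  private variable
    S S′ : State
    Act Act′ : List (Fin r)
    Ts Ts′ Ts″ : List (E × E)

  -- Removing a magnitude from the game

  record Invariant (S : State) (Act : List (Fin r)) (Ts : List (E × E)) : Set where
    field
      uniqueAct  : Unique Act
      uniqueEnds : Unique (ends Ts)
      active     : ∀ {z} → z ∈ ends Ts → mag (lab S z) ∈ Act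

  Solved : State → List (Fin r) → List (E × E) → Set
  Solved S Act Ts = ∃ λ S′ → Confined S S′ Act × SDR (lab S′) Ts

  invariant-after : Confined S S′ Act → Invariant S Act Ts → Invariant S′ Act Ts
  invariant-after conf inv = record
    { uniqueAct = uniqueAct ; uniqueEnds = uniqueEnds ; active = λ z∈ → Confined.inside conf _ (active z∈) }
    where open Invariant inv

  solved-after : Confined S S′ Act → Solved S′ Act Ts → Solved S Act Ts
  solved-after conf (S″ , conf′ , sdr) = S″ , confined-trans conf conf′ , sdr

  -- The rest of the game is confined to the other magnitudes: ends bearing `b` or `neg b` keep
  -- their colour and no other end acquires it, as lifting through the two reductions requires.
  finish : ∀ b → Invariant S Act Ts → Act ↭ mag b ∷ Act′ →
           Reduction (lab S) b Ts Ts′ → Reduction (lab S) (neg b) Ts′ Ts″ →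
           (Invariant S Act′ Ts″ → Solved S Act′ Ts″) → Solved S Act Ts
  finish {S} {Act} {Ts} {Act′} {Ts′} {Ts″} b inv Act↭ red red′ rec with rec inv′
    where
    open Invariant inv
    tail : ∀ {m} {ms : List (Fin r)} → Unique (m ∷ ms) → Unique ms
    tail (_ ∷ u) = u

    still-active : ∀ {z} → z ∈ ends Ts″ → mag (lab S z) ∈ mag b ∷ Act′ → mag (lab S z) ∈ Act′
    still-active z∈ (there m∈) = m∈
    still-active {z} z∈ (here m≡) with same-mag (lab S z) b m≡
    ... | inj₁ ≡b  = ⊥-elim (cnt≡0 (lab S) (Reduction.gone red) (Reduction.remaining red′ z∈) ≡b)
    ... | inj₂ ≡nb = ⊥-elim (cnt≡0 (lab S) (Reduction.gone red′) z∈ ≡nb)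

    inv′ : Invariant S Act′ Ts″
    inv′ = record
      { uniqueAct  = tail (unique-↭ Act↭ uniqueAct)
      ; uniqueEnds = Reduction.unique red′ (Reduction.unique red uniqueEnds)
      ; active     = λ z∈ → still-active z∈ (↭.∈-resp-↭ Act↭
                       (active (Reduction.remaining red (Reduction.remaining red′ z∈))))
      }
  ... | S′ , conf , sdr =
    S′ , confined-mono (λ m∈ → ↭.∈-resp-↭ (↭-sym Act↭) (there m∈)) conf ,
    Reduction.lift red (keeps b b∉) (avoids b b∉)
      (Reduction.lift red′ (keeps (neg b) b∉) (avoids (neg b) b∉) sdr)
    where
    open Invariant inv
    open Confined conf

    b∉ : mag b ∉ Act′
    b∉ = Unique[x∷xs]⇒x∉xs (unique-↭ Act↭ uniqueAct)

    keeps : ∀ c → mag c ∉ Act′ → ∀ z → lab S z ≡ c → lab S′ z ≡ c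
    keeps _ c∉ z refl = outside z c∉

    avoids : ∀ c → mag c ∉ Act′ → ∀ z → lab S z ≢ c → lab S′ z ≢ c
    avoids _ c∉ z ≢c refl with mag (lab S z) ∈ᶠ? Act′
    ... | yes m∈ = c∉ (inside z m∈)
    ... | no m∉  = ≢c (sym (outside z m∉))

  -- The bound `2 * n` is the number of colours of `n` magnitudes; this is the induction hypothesis
  -- for the removal of a magnitude.
  Recursive : ℕ → Set
  Recursive n = ∀ {S Act Ts} → Invariant S Act Ts → length Act ≡ n → length Ts ≤ 2 * n → Solved S Act Ts

  extract-length : ∀ {n m} → m ∈ Act → length Act ≡ suc n → ∃ λ Act′ → Act ↭ m ∷ Act′ × length Act′ ≡ n
  extract-length m∈ len =
    let Act′ , Act↭ = extract m∈ in Act′ , Act↭ , ℕ.suc-injective (trans (sym (↭.↭-length Act↭)) len)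

  module _ {n} (rec : Recursive n) {S Act Ts} (inv : Invariant S Act Ts)
           (|Act| : length Act ≡ suc n) (|Ts| : length Ts ≤ 2 * suc n) where

    private
      ℓ = lab S
      es = ends Ts

    -- The given reduction disposed of one token and `b′` disposes of a second, which matches the
    -- fall of the bound by two. `b′` comes with an equation because `neg (neg a)` does not reduce
    -- to `a`, and callers pass the pair in either order.
    remove-reduced : ∀ b b′ → b′ ≡ neg b → mag b ∈ Act → Reduction ℓ b Ts Ts′ → length Ts ≡ suc (length Ts′) →
                     1 ≤ cnt ℓ b′ (ends Ts′) → cnt ℓ b′ (ends Ts′) ≤ 2 → Solved S Act Ts
    remove-reduced {Ts′} b _ refl b∈ red |Ts′| 1≤ ≤2
      with Act′ , Act↭ , |Act′| ← extract-length b∈ |Act|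
         | Ts″ , red′ , |Ts″| , _ ← reduce Ts′ 1≤ ≤2 =
      finish b inv Act↭ red red′ λ inv′ → rec inv′ |Act′|
        (ℕ.≤-pred (ℕ.≤-pred (subst₂ _≤_ (trans |Ts′| (cong suc |Ts″|)) (ℕ.*-suc 2 n) |Ts|)))

    -- Reducing `b` costs at most one of the two bearers of `b′`, so `b′` still has one to be
    -- reduced afterwards.
    remove : ∀ b b′ → b′ ≡ neg b → mag b ∈ Act → 1 ≤ cnt ℓ b es → cnt ℓ b es ≤ 2 → cnt ℓ b′ es ≡ 2 → Solved S Act Ts
    remove b b′ refl b∈ 1≤ ≤2 ≡2 with Ts′ , red , |Ts′| , keep ← reduce Ts 1≤ ≤2 =
      remove-reduced b b′ refl b∈ red |Ts′|
        (ℕ.≤-pred (subst (_≤ suc (cnt ℓ b′ (ends Ts′))) ≡2 (keep b′ (neg-≢ b))))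
        (subst (cnt ℓ b′ (ends Ts′) ≤_) (trans (sym (Reduction.cnt-split red b′)) ≡2) (ℕ.m≤n+m _ _))

    -- The bound has slack here: weight 0 already gives at most `2 * n` tokens, and weight at most 2
    -- gives at most `2 * n + 1`, so disposing of a single token suffices.
    remove-light : ∀ b → mag b ∈ Act → weight ℓ (mag b) es ≤ 2 →
                   2 * length Ts ≤ weight ℓ (mag b) es + 4 * n → Solved S Act Ts
    remove-light b b∈ ≤2 bound with Act′ , Act↭ , |Act′| ← extract-length b∈ |Act| =
      go (cnt ℓ b es) refl (cnt ℓ (neg b) es) refl
      where
      4n≡ : 4 * n ≡ 2 * (2 * n)
      4n≡ = ℕ.*-assoc 2 2 n

      w≡ : weight ℓ (mag b) es ≡ cnt ℓ b es + cnt ℓ (neg b) es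
      w≡ = weight-split ℓ b es

      cnt-b≤2 : cnt ℓ b es ≤ 2
      cnt-b≤2 = ℕ.≤-trans (ℕ.m≤m+n _ _) (subst (_≤ 2) w≡ ≤2)

      cnt-nb≤2 : cnt ℓ (neg b) es ≤ 2
      cnt-nb≤2 = ℕ.≤-trans (ℕ.m≤n+m _ _) (subst (_≤ 2) w≡ ≤2)

      one-less : ∀ {k} → suc k ≤ length Ts → k ≤ 2 * n
      one-less {k} k< = ℕ.≤-pred (ℕ.*-cancelˡ-≤ 2 (begin
        2 * suc k                      ≤⟨ ℕ.*-monoʳ-≤ 2 k< ⟩
        2 * length Ts                  ≤⟨ bound ⟩
        weight ℓ (mag b) es + 4 * n    ≤⟨ ℕ.+-monoˡ-≤ (4 * n) ≤2 ⟩
        2 + 4 * n                      ≡⟨ cong (2 +_) 4n≡ ⟩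
        2 + 2 * (2 * n)                ≡⟨ ℕ.*-suc 2 (2 * n) ⟨
        2 * suc (2 * n)                ∎))
        where open ℕ.≤-Reasoning

      reduce-any : ∀ c Ts → cnt ℓ c (ends Ts) ≤ 2 → ∃ λ Ts′ → Reduction ℓ c Ts Ts′ × length Ts′ ≤ length Ts
      reduce-any c Ts ≤2 with cnt ℓ c (ends Ts) ℕ.≟ 0
      ... | yes none = Ts , reduce-none none , ℕ.≤-refl
      ... | no some  = let Ts′ , red , |Ts′| , _ = reduce Ts (ℕ.n≢0⇒n>0 some) ≤2
                       in Ts′ , red , subst (length Ts′ ≤_) (sym |Ts′|) (ℕ.n≤1+n _)

      go : ∀ i → cnt ℓ b es ≡ i → ∀ j → cnt ℓ (neg b) es ≡ j → Solved S Act Ts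
      go zero i≡ zero j≡ = finish b inv Act↭ (reduce-none i≡) (reduce-none j≡) λ inv′ → rec inv′ |Act′|
        (ℕ.*-cancelˡ-≤ 2 (subst (2 * length Ts ≤_) (trans (cong (_+ 4 * n) (trans w≡ (cong₂ _+_ i≡ j≡))) 4n≡) bound))
      go zero i≡ (suc j) j≡ with Ts′ , red , |Ts′| , _ ← reduce Ts (subst (1 ≤_) (sym j≡) (s≤s z≤n)) cnt-nb≤2 =
        finish b inv Act↭ (reduce-none i≡) red λ inv′ → rec inv′ |Act′| (one-less (ℕ.≤-reflexive (sym |Ts′|)))
      go (suc i) i≡ _ _ with Ts′ , red , |Ts′| , _ ← reduce Ts (subst (1 ≤_) (sym i≡) (s≤s z≤n)) cnt-b≤2
                        with Ts″ , red′ , ≤Ts′ ← reduce-any (neg b) Ts′ (ℕ.≤-trans (ℕ.m≤n+m _ _)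
                               (subst (_≤ 2) (Reduction.cnt-split red (neg b)) cnt-nb≤2)) =
        finish b inv Act↭ red red′ λ inv′ → rec inv′ |Act′|
          (one-less (subst (suc (length Ts″) ≤_) (sym |Ts′|) (s≤s ≤Ts′)))

  -- Swaps that change the split within a magnitude

  module _ {ℓ : E → Colour r} {x : E} {es rest : List E} (es↭ : es ↭ x ∷ rest) where

    count-∷ : ∀ {d} → ℓ x ≡ d → cnt ℓ d es ≡ suc (cnt ℓ d rest)
    count-∷ x≡d = trans (∑-↭ es↭) (cong (_+ _) (δ-≡ x≡d))

    skip-∷ : ∀ {d} → ℓ x ≢ d → cnt ℓ d es ≡ cnt ℓ d rest
    skip-∷ x≢d = trans (∑-↭ es↭) (cong (_+ _) (δ-≢ x≢d))

  module _ (ℓ : E → Colour r) {y : E} (rest : List E) where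

    count-head : ∀ {d} → ℓ y ≡ d → cnt ℓ d (y ∷ rest) ≡ suc (cnt ℓ d rest)
    count-head = count-∷ {ℓ = ℓ} {rest = rest} ↭-refl

    skip-head : ∀ {d} → ℓ y ≢ d → cnt ℓ d (y ∷ rest) ≡ cnt ℓ d rest
    skip-head = skip-∷ {ℓ = ℓ} {rest = rest} ↭-refl

  bearers : (E → Colour r) → Colour r → List E → List E
  bearers ℓ c = filter (λ z → ℓ z ≟ᶜ c)

  -- The swap of `mag b` with itself under the sign `-` exchanges `b` and `neg b`. Since `neg b` has
  -- no bearer, ends only move from `b` to `neg b`: the starting end, and its partner if that bears
  -- `b`.
  negate : ∀ S b {es k} → Unique es → cnt (lab S) b es ≡ 2 + k → cnt (lab S) (neg b) es ≡ 0 →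
           ∃ λ S′ → Confined S S′ (mag b ∷ []) ×
             ((cnt (lab S′) b es ≡ suc k × cnt (lab S′) (neg b) es ≡ 1)
              ⊎ (cnt (lab S′) b es ≡ k × cnt (lab S′) (neg b) es ≡ 2))
  negate S b@(m , s) {es} {k} uniq b≡ nb≡
    with step S Sign.- uniq (here refl) (here refl) (bearers (lab S) b es) [] (Unique.filter⁺ (λ z → lab S z ≟ᶜ b) uniq)
              (proj₁ ∘ ∈-filter⁻ (λ z → lab S z ≟ᶜ b))
              (subst (0 <_) (sym (trans (length-filter≡cnt (lab S) b es) b≡)) (s≤s z≤n))
  ... | x , S′ , x∈ , conf , eff = S′ , conf , result eff
    where
    ℓ = lab S
    ℓ′ = lab S′
    τ = swap m m Sign.-

    x≡b : ℓ x ≡ b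
    x≡b = proj₂ (∈-filter⁻ (λ z → lab S z ≟ᶜ b) {xs = es} x∈)

    τb≡ : τ b ≡ neg b
    τb≡ = swap-from m m Sign.- s

    x′≡ : ℓ′ x ≡ τ (ℓ x) → ℓ′ x ≡ neg b
    x′≡ eq = trans eq (trans (cong τ x≡b) τb≡)

    x≢nb : ℓ x ≢ neg b
    x≢nb eq = neg-≢ b (trans (sym eq) x≡b)

    result : Effect ℓ ℓ′ τ [] es x →
             (cnt ℓ′ b es ≡ suc k × cnt ℓ′ (neg b) es ≡ 1) ⊎ (cnt ℓ′ b es ≡ k × cnt ℓ′ (neg b) es ≡ 2)
    result (single rest es↭ x-swapped agree) = inj₁
      ( trans (skip-∷ es↭ x′≢b) (trans (cnt-agree agree b) (ℕ.suc-injective (trans (sym (count-∷ es↭ x≡b)) b≡)))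
      , trans (count-∷ es↭ x′≡nb) (cong suc (trans (cnt-agree agree (neg b)) (trans (sym (skip-∷ es↭ x≢nb)) nb≡))) )
      where
      x′≡nb = x′≡ x-swapped
      x′≢b : ℓ′ x ≢ b
      x′≢b eq = neg-≢ b (trans (sym x′≡nb) eq)
    result (double y rest _ es↭ x-swapped y-swapped agree) with ℓ y ≟ᶜ b
    ... | yes y≡b = inj₂
      ( trans (skip-∷ es↭ x′≢b) (trans (skip-head ℓ′ rest y′≢b) (trans (cnt-agree agree b)
          (ℕ.suc-injective (ℕ.suc-injective (trans (sym (trans (count-∷ es↭ x≡b) (cong suc (count-head ℓ rest y≡b)))) b≡)))))
      , trans (count-∷ es↭ x′≡nb) (cong suc (trans (count-head ℓ′ rest y′≡nb) (cong suc (trans (cnt-agree agree (neg b))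
          (trans (sym (trans (skip-∷ es↭ x≢nb) (skip-head ℓ rest y≢nb))) nb≡))))) )
      where
      x′≡nb = x′≡ x-swapped
      x′≢b : ℓ′ x ≢ b
      x′≢b eq = neg-≢ b (trans (sym x′≡nb) eq)
      y′≡nb : ℓ′ y ≡ neg b
      y′≡nb = trans y-swapped (trans (cong τ y≡b) τb≡)
      y′≢b : ℓ′ y ≢ b
      y′≢b eq = neg-≢ b (trans (sym y′≡nb) eq)
      y≢nb : ℓ y ≢ neg b
      y≢nb eq = neg-≢ b (trans (sym eq) y≡b)
    ... | no y≢b = inj₁
      ( trans (skip-∷ es↭ x′≢b) (trans (skip-head ℓ′ rest (y≢b ∘ trans (sym y′≡y))) (trans (cnt-agree agree b)
          (ℕ.suc-injective (trans (sym (trans (count-∷ es↭ x≡b) (cong suc (skip-head ℓ rest y≢b)))) b≡))))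
      , trans (count-∷ es↭ x′≡nb) (cong suc (trans (skip-head ℓ′ rest (y≢nb ∘ trans (sym y′≡y))) (trans (cnt-agree agree (neg b))
          (trans (sym (trans (skip-∷ es↭ x≢nb) (skip-head ℓ rest y≢nb))) nb≡)))) )
      where
      x′≡nb = x′≡ x-swapped
      x′≢b : ℓ′ x ≢ b
      x′≢b eq = neg-≢ b (trans (sym x′≡nb) eq)
      y≢nb : ℓ y ≢ neg b
      y≢nb = cnt≡0 ℓ nb≡ (↭.∈-resp-↭ (↭-sym es↭) (there (here refl)))
      y≢m : mag (ℓ y) ≢ m
      y≢m eq = Sum.[ y≢b , y≢nb ] (same-mag (ℓ y) b eq)
      y′≡y : ℓ′ y ≡ ℓ y
      y′≡y = trans y-swapped (swap-other m m Sign.- (ℓ y) y≢m y≢m)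

  -- Three ends coloured a have together at most two partners coloured c or - a.
  shift : ∀ S {Act es} a c → Unique es → mag a ∈ Act → mag c ∈ Act → mag a ≢ mag c →
          cnt (lab S) a es ≡ 3 → cnt (lab S) (neg a) es ≡ 1 → cnt (lab S) c es ≤ 1 →
          ∃ λ S′ → Confined S S′ Act ×
            ((cnt (lab S′) a es ≡ 2 × 1 ≤ cnt (lab S′) (neg a) es × cnt (lab S′) (neg a) es ≤ 2)
             ⊎ (cnt (lab S′) a es ≡ 1 × cnt (lab S′) (neg a) es ≡ 1 ×
                (∀ {z} → z ∈ es → lab S z ≢ a → lab S′ z ≡ lab S z)))
  shift S {Act} {es} a@(m , s) c@(m′ , s′) uniq a∈ c∈ m≢m′ a≡ na≡ c≤1
    -- With this sign the swap sends `a` to `c`, hence `neg c` to `neg a`. A partner coloured `c`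
    -- would become a new bearer of `a`, and a partner coloured `neg a` would take away its only
    -- bearer; both are avoided.
    with step S (s Sign.* s′) uniq a∈ c∈ (bearers (lab S) a es) (bearers (lab S) c es ++ bearers (lab S) (neg a) es)
              (Unique.filter⁺ (λ z → lab S z ≟ᶜ a) uniq)
              (proj₁ ∘ ∈-filter⁻ (λ z → lab S z ≟ᶜ a))
              (subst₂ _<_ (sym (length-++ (bearers (lab S) c es))) (sym (length-filter≡cnt (lab S) a es))
                (subst₂ _<_ (sym (cong₂ _+_ (length-filter≡cnt (lab S) c es) (length-filter≡cnt (lab S) (neg a) es)))
                  (sym a≡) (s≤s (ℕ.+-mono-≤ c≤1 (ℕ.≤-reflexive na≡)))))
  ... | x , S′ , x∈ , conf , eff = S′ , conf , result eff
    where
    ℓ = lab S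
    ℓ′ = lab S′
    q = s Sign.* s′
    τ = swap m m′ q

    x≡a : ℓ x ≡ a
    x≡a = proj₂ (∈-filter⁻ (λ z → lab S z ≟ᶜ a) {xs = es} x∈)

    τa≡c : τ a ≡ c
    τa≡c = trans (swap-from m m′ q s) (cong (m′ ,_) (lemma s s′))
      where
      lemma : ∀ s s′ → (s Sign.* s′) Sign.* s ≡ s′
      lemma Sign.+ Sign.+ = refl
      lemma Sign.+ Sign.- = refl
      lemma Sign.- Sign.+ = refl
      lemma Sign.- Sign.- = refl

    τnc≡na : τ (neg c) ≡ neg a
    τnc≡na = trans (swap-to m m′ q (opposite s′)) (cong (m ,_) (lemma s s′))
      where
      lemma : ∀ s s′ → (s Sign.* s′) Sign.* opposite s′ ≡ opposite s
      lemma Sign.+ Sign.+ = refl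
      lemma Sign.+ Sign.- = refl
      lemma Sign.- Sign.+ = refl
      lemma Sign.- Sign.- = refl

    c≢a : c ≢ a
    c≢a eq = m≢m′ (sym (cong mag eq))

    c≢na : c ≢ neg a
    c≢na eq = m≢m′ (sym (cong mag eq))

    x≢na : ℓ x ≢ neg a
    x≢na eq = neg-≢ a (trans (sym eq) x≡a)

    result : Effect ℓ ℓ′ τ (bearers ℓ c es ++ bearers ℓ (neg a) es) es x →
             (cnt ℓ′ a es ≡ 2 × 1 ≤ cnt ℓ′ (neg a) es × cnt ℓ′ (neg a) es ≤ 2)
             ⊎ (cnt ℓ′ a es ≡ 1 × cnt ℓ′ (neg a) es ≡ 1 × (∀ {z} → z ∈ es → ℓ z ≢ a → ℓ′ z ≡ ℓ z))
    result (single rest es↭ x-swapped agree) = inj₁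
      ( trans (skip-∷ es↭ (c≢a ∘ trans (sym x′≡c)))
          (trans (cnt-agree agree a) (ℕ.suc-injective (trans (sym (count-∷ es↭ x≡a)) a≡)))
      , ℕ.≤-reflexive (sym na′≡) , ℕ.m≤n⇒m≤1+n (ℕ.≤-reflexive na′≡) )
      where
      x′≡c : ℓ′ x ≡ c
      x′≡c = trans x-swapped (trans (cong τ x≡a) τa≡c)
      na′≡ : cnt ℓ′ (neg a) es ≡ 1
      na′≡ = trans (skip-∷ es↭ (c≢na ∘ trans (sym x′≡c)))
               (trans (cnt-agree agree (neg a)) (trans (sym (skip-∷ es↭ x≢na)) na≡))
    result (double y rest y∉ es↭ x-swapped y-swapped agree) = go (ℓ y ≟ᶜ a) (ℓ y ≟ᶜ neg c)
      where
      y∈ : y ∈ es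
      y∈ = ↭.∈-resp-↭ (↭-sym es↭) (there (here refl))
      y≢c : ℓ y ≢ c
      y≢c y≡c = y∉ (∈-++⁺ˡ (∈-filter⁺ (λ z → ℓ z ≟ᶜ c) y∈ y≡c))
      y≢na : ℓ y ≢ neg a
      y≢na y≡na = y∉ (∈-++⁺ʳ (bearers ℓ c es) (∈-filter⁺ (λ z → ℓ z ≟ᶜ neg a) y∈ y≡na))
      x′≡c : ℓ′ x ≡ c
      x′≡c = trans x-swapped (trans (cong τ x≡a) τa≡c)
      x′≢a : ℓ′ x ≢ a
      x′≢a = c≢a ∘ trans (sym x′≡c)
      x′≢na : ℓ′ x ≢ neg a
      x′≢na = c≢na ∘ trans (sym x′≡c)
      rest-na : cnt ℓ (neg a) rest ≡ 1
      rest-na = trans (sym (trans (skip-∷ es↭ x≢na) (skip-head ℓ rest y≢na))) na≡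

      go : Dec (ℓ y ≡ a) → Dec (ℓ y ≡ neg c) →
           (cnt ℓ′ a es ≡ 2 × 1 ≤ cnt ℓ′ (neg a) es × cnt ℓ′ (neg a) es ≤ 2)
           ⊎ (cnt ℓ′ a es ≡ 1 × cnt ℓ′ (neg a) es ≡ 1 × (∀ {z} → z ∈ es → ℓ z ≢ a → ℓ′ z ≡ ℓ z))
      go (yes y≡a) _ = inj₂
        ( trans (skip-∷ es↭ x′≢a) (trans (skip-head ℓ′ rest (c≢a ∘ trans (sym y′≡c))) (trans (cnt-agree agree a)
            (ℕ.suc-injective (ℕ.suc-injective (trans (sym (trans (count-∷ es↭ x≡a) (cong suc (count-head ℓ rest y≡a)))) a≡)))))
        , trans (skip-∷ es↭ x′≢na) (trans (skip-head ℓ′ rest (c≢na ∘ trans (sym y′≡c)))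
            (trans (cnt-agree agree (neg a)) rest-na))
        , λ z∈ z≢a → unmoved z≢a (↭.∈-resp-↭ es↭ z∈) )
        where
        y′≡c : ℓ′ y ≡ c
        y′≡c = trans y-swapped (trans (cong τ y≡a) τa≡c)
        unmoved : ∀ {z} → ℓ z ≢ a → z ∈ x ∷ y ∷ rest → ℓ′ z ≡ ℓ z
        unmoved z≢a (here refl)         = ⊥-elim (z≢a x≡a)
        unmoved z≢a (there (here refl)) = ⊥-elim (z≢a y≡a)
        unmoved z≢a (there (there z∈))  = agree z∈
      go (no y≢a) (yes y≡nc) = inj₁
        ( trans (skip-∷ es↭ x′≢a) (trans (skip-head ℓ′ rest (neg-≢ a ∘ trans (sym y′≡na))) (trans (cnt-agree agree a)
            (ℕ.suc-injective (trans (sym (trans (count-∷ es↭ x≡a) (cong suc (skip-head ℓ rest y≢a)))) a≡))))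
        , subst (1 ≤_) (sym na′≡) (s≤s z≤n) , ℕ.≤-reflexive na′≡ )
        where
        y′≡na : ℓ′ y ≡ neg a
        y′≡na = trans y-swapped (trans (cong τ y≡nc) τnc≡na)
        na′≡ : cnt ℓ′ (neg a) es ≡ 2
        na′≡ = trans (skip-∷ es↭ x′≢na) (trans (count-head ℓ′ rest y′≡na)
                 (cong suc (trans (cnt-agree agree (neg a)) rest-na)))
      go (no y≢a) (no y≢nc) = inj₁
        ( trans (skip-∷ es↭ x′≢a) (trans (skip-head ℓ′ rest (y≢a ∘ trans (sym y′≡y))) (trans (cnt-agree agree a)
            (ℕ.suc-injective (trans (sym (trans (count-∷ es↭ x≡a) (cong suc (skip-head ℓ rest y≢a)))) a≡))))
        , ℕ.≤-reflexive (sym na′≡) , ℕ.m≤n⇒m≤1+n (ℕ.≤-reflexive na′≡) )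
        where
        y′≡y : ℓ′ y ≡ ℓ y
        y′≡y = trans y-swapped (swap-other m m′ q (ℓ y)
                 (λ eq → Sum.[ y≢a , y≢na ] (same-mag (ℓ y) a eq))
                 (λ eq → Sum.[ y≢c , y≢nc ] (same-mag (ℓ y) c eq)))
        na′≡ : cnt ℓ′ (neg a) es ≡ 1
        na′≡ = trans (skip-∷ es↭ x′≢na) (trans (skip-head ℓ′ rest (y≢na ∘ trans (sym y′≡y)))
                 (trans (cnt-agree agree (neg a)) rest-na))

  -- Magnitudes of weight three and four

  module _ {n} (rec : Recursive n) where

    -- If the two ends of the token bearing - a have different magnitudes, a swap with the second
    -- one makes the magnitude of a removable.
    three-one : ∀ a → Invariant S Act Ts → length Act ≡ suc n → length Ts ≤ 2 * suc n →
                (∀ {m} → m ∈ Act → weight (lab S) m (ends Ts) ≡ 4) → mag a ∈ Act →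
                cnt (lab S) a (ends Ts) ≡ 3 → cnt (lab S) (neg a) (ends Ts) ≡ 1 → Solved S Act Ts
    three-one {S} {Act} {Ts} a inv |Act| |Ts| all4 a∈ a≡3 na≡1
      with cnt-pos (ends Ts) (ℕ.≤-reflexive (sym na≡1))
    ... | x , x∈ , x≡na with split Ts x∈
    ...   | y , Ts′ , s = go (ℓ y ≟ᶜ a)
      where
      open Invariant inv
      ℓ = lab S
      es = ends Ts

      x≢a : ℓ x ≢ a
      x≢a eq = neg-≢ a (trans (sym x≡na) eq)

      rest≡0 : δ (ℓ y) (neg a) + cnt ℓ (neg a) (ends Ts′) ≡ 0
      rest≡0 = ℕ.suc-injective (trans (sym (count-∷ {ℓ = ℓ} (split-↭ s) x≡na)) na≡1)

      y≢na : ℓ y ≢ neg a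
      y≢na eq with trans (sym (δ-≡ eq)) (ℕ.m+n≡0⇒m≡0 (δ (ℓ y) (neg a)) rest≡0)
      ... | ()

      y∈ : y ∈ es
      y∈ = ↭.∈-resp-↭ (↭-sym (split-↭ s)) (there (here refl))

      lighter-colour : ∀ d i j → cnt ℓ d es ≡ i → cnt ℓ (neg d) es ≡ j → i + j ≡ 4 →
                       (∃ λ c → mag c ≡ mag d × cnt ℓ c es ≤ 1) ⊎ (cnt ℓ d es ≡ 2 × cnt ℓ (neg d) es ≡ 2)
      lighter-colour d 0 _ i≡ _  _    = inj₁ (d , refl , subst (_≤ 1) (sym i≡) z≤n)
      lighter-colour d 1 _ i≡ _  _    = inj₁ (d , refl , subst (_≤ 1) (sym i≡) (s≤s z≤n))
      lighter-colour d 2 2 i≡ j≡ refl = inj₂ (i≡ , j≡)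
      lighter-colour d 3 1 _  j≡ refl = inj₁ (neg d , refl , subst (_≤ 1) (sym j≡) (s≤s z≤n))
      lighter-colour d 4 0 _  j≡ refl = inj₁ (neg d , refl , subst (_≤ 1) (sym j≡) z≤n)

      go : Dec (ℓ y ≡ a) → Solved S Act Ts
      -- Giving `neg a` to this token also discards one bearer of `a`, so two remain and `a` becomes
      -- reducible.
      go (yes y≡a) = remove-reduced rec inv |Act| |Ts| (neg a) a (sym (neg-involutive a)) a∈
        (reduce-leaf s x≡na (ℕ.m+n≡0⇒n≡0 (δ (ℓ y) (neg a)) rest≡0)) (split-length s)
        (subst (1 ≤_) (sym a≡2) (s≤s z≤n)) (ℕ.≤-reflexive a≡2)
        where
        a≡2 : cnt ℓ a (ends Ts′) ≡ 2
        a≡2 = ℕ.suc-injective (trans (sym (trans (skip-∷ {ℓ = ℓ} (split-↭ s) x≢a) (count-head ℓ (ends Ts′) y≡a))) a≡3)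
      go (no y≢a) with lighter-colour (ℓ y) _ _ refl refl (trans (sym (weight-split ℓ (ℓ y) es)) (all4 (active y∈)))
      -- The magnitude of `ℓ y` is evenly split and can be removed in place of that of `a`.
      ... | inj₂ (≡2 , ≡2′) = remove rec inv |Act| |Ts| (ℓ y) _ refl (active y∈)
                                (subst (1 ≤_) (sym ≡2) (s≤s z≤n)) (ℕ.≤-reflexive ≡2) ≡2′
      ... | inj₁ (c , c≡ , c≤1) with shift S a c uniqueEnds a∈ (subst (_∈ Act) (sym c≡) (active y∈))
                                       (λ a≡c → Sum.[ y≢a , y≢na ] (same-mag (ℓ y) a (sym (trans a≡c c≡)))) a≡3 na≡1 c≤1
      ...   | S′ , conf , inj₁ (a≡2 , 1≤ , ≤2) = solved-after conf
        (remove rec (invariant-after conf inv) |Act| |Ts| (neg a) a (sym (neg-involutive a)) a∈ 1≤ ≤2 a≡2)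
      -- Now `a` and `neg a` have one bearer each. As `y` was not moved, it does not bear `a`; the
      -- two bearers lie on different tokens and two tokens can be settled.
      ...   | S′ , conf , inj₂ (a≡1 , na′≡1 , unmoved) = solved-after conf
        (remove-reduced rec (invariant-after conf inv) |Act| |Ts| (neg a) a (sym (neg-involutive a)) a∈
          (reduce-leaf s x′≡na (ℕ.m+n≡0⇒n≡0 (δ (lab S′ y) (neg a)) rest′≡0)) (split-length s)
          (ℕ.≤-reflexive (sym left≡1)) (subst (_≤ 2) (sym left≡1) (s≤s z≤n)))
        where
        x′≡na : lab S′ x ≡ neg a
        x′≡na = trans (unmoved x∈ x≢a) x≡na
        y′≢a : lab S′ y ≢ a
        y′≢a eq = y≢a (trans (sym (unmoved y∈ y≢a)) eq)
        rest′≡0 : δ (lab S′ y) (neg a) + cnt (lab S′) (neg a) (ends Ts′) ≡ 0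
        rest′≡0 = ℕ.suc-injective (trans (sym (count-∷ {ℓ = lab S′} (split-↭ s) x′≡na)) na′≡1)
        left≡1 : cnt (lab S′) a (ends Ts′) ≡ 1
        left≡1 = trans (sym (trans (skip-∷ {ℓ = lab S′} (split-↭ s) (x≢a ∘ trans (sym (unmoved x∈ x≢a))))
                                   (skip-head (lab S′) (ends Ts′) y′≢a))) a≡1

    weight-confined : ∀ {m k} es → Confined S S′ (m ∷ []) → k ≢ m → weight (lab S′) k es ≡ weight (lab S) k es
    weight-confined {S} {S′} {m} {k} es conf k≢m = ∑-cong es λ {z} _ → eq z (mag (lab S z) Fin.≟ m)
      where
      open Confined conf
      eq : ∀ z → Dec (mag (lab S z) ≡ m) → 𝟙 (mag (lab S′ z) Fin.≟ k) ≡ 𝟙 (mag (lab S z) Fin.≟ k)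
      eq z (no ≢m)  = cong (λ d → 𝟙 (mag d Fin.≟ k)) (outside z λ { (here ≡m) → ≢m ≡m })
      eq z (yes ≡m) with inside z (here ≡m)
      ... | here ≡m′ = trans (𝟙-no (_ Fin.≟ _) λ ≡k → k≢m (trans (sym ≡k) ≡m′))
                             (sym (𝟙-no (_ Fin.≟ _) λ ≡k → k≢m (trans (sym ≡k) ≡m)))

    confined-∈ : ∀ {m} → m ∈ Act → Confined S S′ (m ∷ []) → Confined S S′ Act
    confined-∈ m∈ = confined-mono λ { (here refl) → m∈ }

    -- A split 2+1 can be removed at once, and a split 3+0 is turned into 2+1 or 1+2 by a negation.
    weight-three : ∀ m → Invariant S Act Ts → length Act ≡ suc n → length Ts ≤ 2 * suc n →
                   m ∈ Act → weight (lab S) m (ends Ts) ≡ 3 → Solved S Act Ts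
    weight-three {S} {Act} {Ts} m inv |Act| |Ts| m∈ ≡3 =
      go _ _ refl refl (trans (sym (weight-split (lab S) b (ends Ts))) ≡3)
      where
      open Invariant inv
      b nb : Colour r
      b  = m , Sign.+
      nb = m , Sign.-

      one-two : ∀ {S} b b′ → Invariant S Act Ts → b′ ≡ neg b → mag b ∈ Act →
                cnt (lab S) b (ends Ts) ≡ 1 → cnt (lab S) b′ (ends Ts) ≡ 2 → Solved S Act Ts
      one-two b b′ inv b′≡ b∈ ≡1 ≡2 = remove rec inv |Act| |Ts| b b′ b′≡ b∈
        (ℕ.≤-reflexive (sym ≡1)) (subst (_≤ 2) (sym ≡1) (s≤s z≤n)) ≡2

      three-zero : ∀ b b′ → b′ ≡ neg b → b ≡ neg b′ → mag b ≡ m →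
                   cnt (lab S) b (ends Ts) ≡ 3 → cnt (lab S) b′ (ends Ts) ≡ 0 → Solved S Act Ts
      three-zero b b′ refl b≡ refl ≡3 ≡0 with negate S b uniqueEnds ≡3 ≡0
      ... | S′ , conf , inj₁ (≡2 , ≡1) = let conf′ = confined-∈ m∈ conf in
        solved-after conf′ (one-two b′ b (invariant-after conf′ inv) b≡ m∈ ≡1 ≡2)
      ... | S′ , conf , inj₂ (≡1 , ≡2) = let conf′ = confined-∈ m∈ conf in
        solved-after conf′ (one-two b b′ (invariant-after conf′ inv) refl m∈ ≡1 ≡2)

      go : ∀ i j → cnt (lab S) b (ends Ts) ≡ i → cnt (lab S) nb (ends Ts) ≡ j → i + j ≡ 3 → Solved S Act Ts
      go 0 3 ≡0 ≡3 refl = three-zero nb b refl refl refl ≡3 ≡0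
      go 1 2 ≡1 ≡2 refl = one-two b nb inv refl m∈ ≡1 ≡2
      go 2 1 ≡2 ≡1 refl = one-two nb b inv refl m∈ ≡1 ≡2
      go 3 0 ≡3 ≡0 refl = three-zero b nb refl refl refl ≡3 ≡0

    -- A split 2+2 can be removed, and a negation turns 4+0 into 2+2 or 3+1. The split 3+1 draws on
    -- another magnitude, hence the assumption on all weights and the care to preserve it under
    -- negation.
    weights-four : ∀ m → Invariant S Act Ts → length Act ≡ suc n → length Ts ≤ 2 * suc n →
                   (∀ {k} → k ∈ Act → weight (lab S) k (ends Ts) ≡ 4) → m ∈ Act → Solved S Act Ts
    weights-four {S} {Act} {Ts} m inv |Act| |Ts| all4 m∈ =
      go _ _ refl refl (trans (sym (weight-split (lab S) b (ends Ts))) (all4 m∈))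
      where
      open Invariant inv
      b nb : Colour r
      b  = m , Sign.+
      nb = m , Sign.-

      two-two : ∀ {S} b → Invariant S Act Ts → mag b ∈ Act →
                cnt (lab S) b (ends Ts) ≡ 2 → cnt (lab S) (neg b) (ends Ts) ≡ 2 → Solved S Act Ts
      two-two b inv b∈ ≡2 ≡2′ = remove rec inv |Act| |Ts| b _ refl b∈
        (subst (1 ≤_) (sym ≡2) (s≤s z≤n)) (ℕ.≤-reflexive ≡2) ≡2′

      four-zero : ∀ b → mag b ≡ m → cnt (lab S) b (ends Ts) ≡ 4 → cnt (lab S) (neg b) (ends Ts) ≡ 0 → Solved S Act Ts
      four-zero b refl ≡4 ≡0 with negate S b uniqueEnds ≡4 ≡0
      ... | S′ , conf , inj₂ (≡2 , ≡2′) = let conf′ = confined-∈ m∈ conf in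
        solved-after conf′ (two-two b (invariant-after conf′ inv) m∈ ≡2 ≡2′)
      ... | S′ , conf , inj₁ (≡3 , ≡1) = let conf′ = confined-∈ m∈ conf in
        solved-after conf′ (three-one b (invariant-after conf′ inv) |Act| |Ts| all4′ m∈ ≡3 ≡1)
        where
        all4′ : ∀ {k} → k ∈ Act → weight (lab S′) k (ends Ts) ≡ 4
        all4′ {k} k∈ with k Fin.≟ mag b
        ... | yes refl = trans (weight-split (lab S′) b (ends Ts)) (cong₂ _+_ ≡3 ≡1)
        ... | no k≢m   = trans (weight-confined (ends Ts) conf k≢m) (all4 k∈)

      go : ∀ i j → cnt (lab S) b (ends Ts) ≡ i → cnt (lab S) nb (ends Ts) ≡ j → i + j ≡ 4 → Solved S Act Ts
      go 0 4 ≡0 ≡4 refl = four-zero nb refl ≡4 ≡0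
      go 1 3 ≡1 ≡3 refl = three-one nb inv |Act| |Ts| all4 m∈ ≡3 ≡1
      go 2 2 ≡2 ≡2′ refl = two-two b inv m∈ ≡2 ≡2′
      go 3 1 ≡3 ≡1 refl = three-one b inv |Act| |Ts| all4 m∈ ≡3 ≡1
      go 4 0 ≡4 ≡0 refl = four-zero b refl ≡4 ≡0

  -- Balancing the weights; induction on the number of magnitudes

  total-weight : ∀ {ℓ : E → Colour r} es → Unique Act → (∀ {z} → z ∈ es → mag (ℓ z) ∈ Act) →
                 ∑ Act (λ m → weight ℓ m es) ≡ length es
  total-weight {Act} {ℓ} es uniq active = begin
    ∑ Act (λ m → weight ℓ m es)                             ≡⟨ ∑-swap Act es _ ⟩
    ∑ es (λ z → ∑ Act (λ m → 𝟙 (mag (ℓ z) Fin.≟ m)))        ≡⟨ ∑-cong es (λ z∈ → ∑-𝟙≟ Fin._≟_ uniq (active z∈)) ⟩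
    ∑ es (λ _ → 1)                                          ≡⟨ ∑-const es 1 ⟩
    length es * 1                                           ≡⟨ ℕ.*-identityʳ _ ⟩
    length es                                               ∎
    where open ≡-Reasoning

  -- Only weights below 3 contribute. A magnitude with at least five offers loses at most two in a
  -- swap, so it still contributes nothing afterwards.
  deficit : State → List (Fin r) → List (E × E) → ℕ
  deficit S Act Ts = ∑ Act λ m → 3 ∸ weight (lab S) m (ends Ts)

  lower-deficit : ∀ {S m m′} → Invariant S Act Ts → m ∈ Act → m′ ∈ Act →
                  weight (lab S) m (ends Ts) ≤ 2 → 5 ≤ weight (lab S) m′ (ends Ts) →
                  ∃ λ S′ → Confined S S′ Act × deficit S′ Act Ts < deficit S Act Ts
  lower-deficit {Act} {Ts} {S} {m} {m′} inv m∈ m′∈ ≤2 5≤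
    with raise S (Invariant.uniqueEnds inv) m∈ m′∈ (ℕ.≤-trans (s≤s ≤2) (ℕ.≤-trans (ℕ.m≤m+n 3 2) 5≤))
  ... | S′ , conf , up , down , others = S′ , conf , ∑-mono-< (λ {k} _ → 3∸≤ k) m∈
    (ℕ.≤-<-trans (ℕ.∸-monoʳ-≤ 3 up) (ℕ.∸-monoʳ-< (ℕ.n<1+n (w m)) (s≤s ≤2)))
    where
    w w′ : Fin r → ℕ
    w  k = weight (lab S) k (ends Ts)
    w′ k = weight (lab S′) k (ends Ts)

    3∸≤ : ∀ k → 3 ∸ w′ k ≤ 3 ∸ w k
    3∸≤ k with k Fin.≟ m | k Fin.≟ m′
    ... | yes refl | _        = ℕ.∸-monoʳ-≤ 3 (ℕ.<⇒≤ up)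
    ... | no _     | yes refl = ℕ.≤-trans (ℕ.≤-reflexive (ℕ.m≤n⇒m∸n≡0 (ℕ.+-cancelˡ-≤ 2 3 (w′ m′) (ℕ.≤-trans 5≤ down)))) z≤n
    ... | no k≢m   | no k≢m′  = ℕ.∸-monoʳ-≤ 3 (others k k≢m k≢m′)

  -- The number `d` bounds the deficit, which every balancing swap lowers. Without a weight above 4,
  -- the magnitudes other than a light one carry at most `4 * n` offers. If no weight is 3 or less,
  -- all are at least 4 while their sum is at most `4 * suc n`, so all equal 4.
  solve-suc : ∀ {n} → Recursive n → ∀ d {S Act Ts} → Invariant S Act Ts → length Act ≡ suc n → length Ts ≤ 2 * suc n →
              deficit S Act Ts ≤ d → Solved S Act Ts
  solve-suc {n} rec d {S} {Act} {Ts} inv |Act| |Ts| def≤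
    with Any.any? (λ m → w m ℕ.≤? 2) Act | Any.any? (λ m → w m ℕ.≟ 3) Act | Any.any? (λ m → 5 ℕ.≤? w m) Act
    where
    w : Fin r → ℕ
    w m = weight (lab S) m (ends Ts)
  ... | yes light | _ | yes heavy =
    let m , m∈ , ≤2 = find light
        m′ , m′∈ , 5≤ = find heavy
        _ , conf , lower = lower-deficit inv m∈ m′∈ ≤2 5≤
    in continue d def≤ conf lower
    where
    continue : ∀ {S⁺} d → deficit S Act Ts ≤ d → Confined S S⁺ Act → deficit S⁺ Act Ts < deficit S Act Ts →
               Solved S Act Ts
    continue zero    def≤ _    lower = ⊥-elim (ℕ.n≮0 (ℕ.≤-trans lower def≤))
    continue (suc d) def≤ conf lower = solved-after conf
      (solve-suc rec d (invariant-after conf inv) |Act| |Ts| (ℕ.≤-pred (ℕ.≤-trans lower def≤)))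
  ... | yes light | _ | no ¬heavy with find light
  ...   | m , m∈ , m≤2 with extract-length m∈ |Act|
  ...     | Act′ , Act↭ , |Act′| =
    remove-light rec inv |Act| |Ts| (m , Sign.+) m∈ m≤2 (begin
      2 * length Ts                      ≡⟨ length-ends Ts ⟨
      length (ends Ts)                   ≡⟨ total-weight {ℓ = lab S} (ends Ts) uniqueAct active ⟨
      ∑ Act w                            ≡⟨ ∑-↭ Act↭ ⟩
      w m + ∑ Act′ w                     ≤⟨ ℕ.+-monoʳ-≤ (w m) (∑-mono Act′ λ k∈ → w≤4 (↭.∈-resp-↭ (↭-sym Act↭) (there k∈))) ⟩
      w m + ∑ Act′ (λ _ → 4)             ≡⟨ cong (w m +_) (trans (∑-const Act′ 4) (trans (cong (_* 4) |Act′|) (ℕ.*-comm n 4))) ⟩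
      w m + 4 * n                        ∎)
    where
    open Invariant inv
    open ℕ.≤-Reasoning
    w : Fin r → ℕ
    w m = weight (lab S) m (ends Ts)
    w≤4 : ∀ {k} → k ∈ Act → w k ≤ 4
    w≤4 k∈ = ℕ.≤-pred (ℕ.≰⇒> λ 5≤ → ¬heavy (Any.map (λ { refl → 5≤ }) k∈))
  solve-suc {n} rec d inv |Act| |Ts| def≤ | no _ | yes three | _ =
    let m , m∈ , ≡3 = find three in
    weight-three rec m inv |Act| |Ts| m∈ ≡3
  solve-suc {n} rec d {S} {Act@(m ∷ _)} {Ts} inv |Act| |Ts| def≤ | no ¬light | no ¬three | _ =
    weights-four rec m inv |Act| |Ts|
      (λ k∈ → ℕ.≤-antisym (w≤4 k∈) (4≤w k∈)) (here refl)
    where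
    open Invariant inv
    w : Fin r → ℕ
    w m = weight (lab S) m (ends Ts)

    4≤w : ∀ {k} → k ∈ Act → 4 ≤ w k
    4≤w k∈ = ℕ.≤∧≢⇒< (ℕ.≰⇒> λ ≤2 → ¬light (Any.map (λ { refl → ≤2 }) k∈))
                     (λ ≡3 → ¬three (Any.map (λ { refl → sym ≡3 }) k∈))

    w≤4 : ∀ {k} → k ∈ Act → w k ≤ 4
    w≤4 {k} k∈ with Act′ , Act↭ , |Act′| ← extract-length k∈ |Act| = ℕ.+-cancelʳ-≤ (4 * n) (w k) 4 (begin
      w k + 4 * n             ≡⟨ cong (w k +_) (trans (ℕ.*-comm 4 n) (trans (cong (_* 4) (sym |Act′|)) (sym (∑-const Act′ 4)))) ⟩
      w k + ∑ Act′ (λ _ → 4)  ≤⟨ ℕ.+-monoʳ-≤ (w k) (∑-mono Act′ λ j∈ → 4≤w (↭.∈-resp-↭ (↭-sym Act↭) (there j∈))) ⟩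
      w k + ∑ Act′ w          ≡⟨ ∑-↭ Act↭ ⟨
      ∑ Act w                 ≡⟨ total-weight {ℓ = lab S} (ends Ts) uniqueAct active ⟩
      length (ends Ts)        ≡⟨ length-ends Ts ⟩
      2 * length Ts           ≤⟨ ℕ.*-monoʳ-≤ 2 |Ts| ⟩
      2 * (2 * suc n)         ≡⟨ ℕ.*-assoc 2 2 (suc n) ⟨
      4 * suc n               ≡⟨ ℕ.*-suc 4 n ⟩
      4 + 4 * n               ∎)
      where open ℕ.≤-Reasoning

  solve : ∀ n → Recursive n
  solve zero {S} {Ts = []} _ _ _ = S , confined-refl , record
    { chosen = [] ; chosen⊆ = λ () ; hits = λ () ; injective = λ () }
  solve (suc n) inv |Act| |Ts| = solve-suc (solve n) _ inv |Act| |Ts| ℕ.≤-refl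

-- Kempe chains along half-edges

-- Half-edges X, joined in pairs by α, together with pendant half-edges Y; only the elements of hs
-- are coloured.
record HalfEdges : Set₁ where
  field
    {X Y V}      : Set
    _≟ˣ_         : DecidableEquality X
    _≟ʸ_         : DecidableEquality Y
    _≟ⱽ_         : DecidableEquality V
    α            : X → X
    α-involutive : ∀ x → α (α x) ≡ x
    sign         : X → Sign
    at           : X ⊎ Y → V
    hs           : List (X ⊎ Y)
    α-closed     : ∀ {x} → inj₁ x ∈ hs → inj₁ (α x) ∈ hs

  _≟_ : DecidableEquality (X ⊎ Y)
  _≟_ = Sum.≡-dec _≟ˣ_ _≟ʸ_

  record Colouring (r : ℕ) : Set where
    field
      col    : X ⊎ Y → Colour r
      proper : ∀ {h h′} → h ∈ hs → h′ ∈ hs → at h ≡ at h′ → col h ≡ col h′ → h ≡ h′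
      signed : ∀ {x} → inj₁ x ∈ hs → col (inj₁ x) ≡ sign x · col (inj₁ (α x))

module KempeChain {r} (H : HalfEdges) (pendant : ∀ y → inj₂ y ∈ HalfEdges.hs H)
                  (S : HalfEdges.Colouring H r) {τ : Colour r → Colour r} (isSwap : IsSwap τ) where

  open HalfEdges H
  open Colouring S
  open IsSwap isSwap
  open DecMembership _≟_ using (_∈?_)

  -- Without `distinct`, a half-edge whose colour is fixed by `τ` would be its own partner.
  record Partner (h h′ : X ⊎ Y) : Set where
    constructor partner
    field
      live     : h′ ∈ hs
      distinct : h′ ≢ h
      same-at  : at h′ ≡ at h
      swapped  : col h′ ≡ τ (col h)

  partner-sym : ∀ {h h′} → h ∈ hs → Partner h h′ → Partner h′ h
  partner-sym h∈ (partner _ ≢h at≡ col≡) =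
    partner h∈ (≢h ∘ sym) (sym at≡) (trans (sym (involutive _)) (cong τ (sym col≡)))

  partner-functional : ∀ {h h₁ h₂} → Partner h h₁ → Partner h h₂ → h₁ ≡ h₂
  partner-functional (partner h₁∈ _ at₁ col₁) (partner h₂∈ _ at₂ col₂) =
    proper h₁∈ h₂∈ (trans at₁ (sym at₂)) (trans col₁ (sym col₂))

  partner-injective : ∀ {h h₁ h₂} → h₁ ∈ hs → h₂ ∈ hs → Partner h₁ h → Partner h₂ h → h₁ ≡ h₂
  partner-injective h₁∈ h₂∈ p₁ p₂ = partner-functional (partner-sym h₁∈ p₁) (partner-sym h₂∈ p₂)

  partner? : ∀ h → Dec (∃ (Partner h))
  partner? h = map′ (λ any → let h′ , h′∈ , q = find any in h′ , partner h′∈ (proj₁ q) (proj₁ (proj₂ q)) (proj₂ (proj₂ q)))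
                    (λ (h′ , p) → let open Partner p in lose live (distinct , same-at , swapped))
                    (Any.any? (λ h′ → ¬? (h′ ≟ h) ×-dec (at h′ ≟ⱽ at h) ×-dec (col h′ ≟ᶜ τ (col h))) hs)

  -- The second index is the pendant half-edge at which the chain ends, if it ends at one.
  data Chain : X ⊎ Y → Maybe Y → List (X ⊎ Y) → Set where
    stop  : ∀ {h} → ¬ ∃ (Partner h) → Chain h nothing (h ∷ [])
    reach : ∀ {h e} → Partner h (inj₂ e) → Chain h (just e) (h ∷ inj₂ e ∷ [])
    cross : ∀ {h x e hs} → Partner h (inj₁ x) → Chain (inj₁ (α x)) e hs → Chain h e (h ∷ inj₁ x ∷ hs)

  start∈ : ∀ {h e C} → Chain h e C → h ∈ C
  start∈ (stop _)    = here refl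
  start∈ (reach _)   = here refl
  start∈ (cross _ _) = here refl

  chain-partner : ∀ {h e C h₁ h₂} → h ∈ hs → Chain h e C → h₁ ∈ C → Partner h₁ h₂ → h₂ ∈ C
  chain-partner h∈ (stop ¬p)   (here refl)         p  = ⊥-elim (¬p (_ , p))
  chain-partner h∈ (reach p)   (here refl)         p′ = there (here (partner-functional p′ p))
  chain-partner h∈ (reach p)   (there (here refl)) p′ = here (partner-functional p′ (partner-sym h∈ p))
  chain-partner h∈ (cross p c) (here refl)         p′ = there (here (partner-functional p′ p))
  chain-partner h∈ (cross p c) (there (here refl)) p′ = here (partner-functional p′ (partner-sym h∈ p))
  chain-partner h∈ (cross p c) (there (there h₁∈)) p′ =
    there (there (chain-partner (α-closed (Partner.live p)) c h₁∈ p′))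

  -- Only the start of a chain can lack the other half of its edge. The chains that are recoloured
  -- start at a pendant half-edge, so they recolour edges as a whole.
  chain-α : ∀ {h e C x} → Chain h e C → inj₁ x ∈ C → inj₁ (α x) ∈ C ⊎ inj₁ x ≡ h
  chain-α (stop _)    (here refl)         = inj₂ refl
  chain-α (reach _)   (here refl)         = inj₂ refl
  chain-α (reach _)   (there (here ()))
  chain-α (cross _ _) (here refl)         = inj₂ refl
  chain-α (cross _ c) (there (here refl)) = inj₁ (there (there (start∈ c)))
  chain-α (cross _ c) (there (there x∈)) with chain-α c x∈
  ... | inj₁ αx∈  = inj₁ (there (there αx∈))
  ... | inj₂ refl = inj₁ (there (here (cong inj₁ (α-involutive _))))

  chain-ends : ∀ {h e C z} → Chain h e C → inj₂ z ∈ C → inj₂ z ≡ h ⊎ e ≡ just z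
  chain-ends (stop _)    (here refl)         = inj₁ refl
  chain-ends (reach _)   (here refl)         = inj₁ refl
  chain-ends (reach _)   (there (here refl)) = inj₂ refl
  chain-ends (cross _ _) (here refl)         = inj₁ refl
  chain-ends (cross _ c) (there (there z∈)) with chain-ends c z∈
  ... | inj₂ e≡ = inj₂ e≡

  chain-end∈ : ∀ {h z C} → Chain h (just z) C → inj₂ z ∈ C
  chain-end∈ (reach _)   = there (here refl)
  chain-end∈ (cross _ c) = there (there (chain-end∈ c))

  data Steps (e : Y) : ℕ → X ⊎ Y → Set where
    none : Steps e 0 (inj₂ e)
    more : ∀ {i h x} → Steps e i h → Partner h (inj₁ x) → Steps e (suc i) (inj₁ (α x))

  α-injective : ∀ {x y} → α x ≡ α y → x ≡ y
  α-injective eq = trans (sym (α-involutive _)) (trans (cong α eq) (α-involutive _))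

  module _ {e : Y} where

    steps∈ : ∀ {i h} → Steps e i h → h ∈ hs
    steps∈ none       = pendant e
    steps∈ (more _ p) = α-closed (Partner.live p)

    -- Each step can be undone uniquely, and the pendant start has no predecessor. So the walk never
    -- revisits a half-edge, which bounds its length and lets the chain terminate.
    steps-injective : ∀ {i j h h′} → Steps e i h → Steps e j h′ → h ≡ h′ → i ≡ j
    steps-injective none       none         _  = refl
    steps-injective (more s p) (more s′ p′) eq with refl ← α-injective (Sum.inj₁-injective eq) =
      cong suc (steps-injective s s′ (partner-injective (steps∈ s) (steps∈ s′) p p′))

    trace : ∀ {i h} → Steps e i h → List (X ⊎ Y)
    trace none                = inj₂ e ∷ []
    trace (more {x = x} s _)  = inj₁ (α x) ∷ trace s

    trace-length : ∀ {i h} (s : Steps e i h) → length (trace s) ≡ suc i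
    trace-length none       = refl
    trace-length (more s _) = cong suc (trace-length s)

    trace-steps : ∀ {i h h′} (s : Steps e i h) → h′ ∈ trace s → ∃ λ j → j ≤ i × Steps e j h′
    trace-steps none         (here refl) = 0 , z≤n , none
    trace-steps s@(more _ _) (here refl) = _ , ℕ.≤-refl , s
    trace-steps (more s _)   (there h∈)  = let j , j≤ , s′ = trace-steps s h∈ in j , ℕ.m≤n⇒m≤1+n j≤ , s′

    trace-unique : ∀ {i h} (s : Steps e i h) → Unique (trace s)
    trace-unique none         = All.[] ∷ []
    trace-unique s@(more s′ _) = All.tabulate (λ h∈ ≡h → let j , j≤ , s″ = trace-steps s′ h∈ in
      ℕ.<⇒≢ (s≤s j≤) (steps-injective s″ s (sym ≡h))) ∷ trace-unique s′

    steps-bounded : ∀ {i h} → Steps e i h → i < length hs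
    steps-bounded s = subst (_≤ length hs) (trace-length s)
      (unique-length (trace-unique s) λ h∈ → steps∈ (proj₂ (proj₂ (trace-steps s h∈))))

    chain-from : ∀ fuel {i h} → Steps e i h → length hs ≤ i + fuel → ∃₂ (Chain h)
    chain-from zero {i} s ≤i = ⊥-elim (ℕ.<⇒≱ (steps-bounded s) (subst (length hs ≤_) (ℕ.+-identityʳ i) ≤i))
    chain-from (suc fuel) {i} {h} s ≤i with partner? h
    ... | no ¬p            = _ , _ , stop ¬p
    ... | yes (inj₂ _ , p) = _ , _ , reach p
    ... | yes (inj₁ x , p) = let _ , _ , c = chain-from fuel (more s p) (subst (length hs ≤_) (ℕ.+-suc i fuel) ≤i)
                             in _ , _ , cross p c

  chain : ∀ e → ∃₂ (Chain (inj₂ e))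
  chain e = chain-from (length hs) none ℕ.≤-refl

  -- A chain without its list of visited half-edges, in a form that can be reversed.
  data Path : X ⊎ Y → X ⊎ Y → Set where
    last : ∀ {h h′} → Partner h h′ → Path h h′
    _▸_  : ∀ {h x h′} → Partner h (inj₁ x) → Path (inj₁ (α x)) h′ → Path h h′

  extend : ∀ {h x h′} → Path h (inj₁ x) → Partner (inj₁ (α x)) h′ → Path h h′
  extend (last p) p′ = p ▸ last p′
  extend (p ▸ ps) p′ = p ▸ extend ps p′

  reverse : ∀ {h h′} → h ∈ hs → Path h h′ → Path h′ h
  reverse h∈ (last p)         = last (partner-sym h∈ p)
  reverse h∈ (_▸_ {h} {x} p ps) = extend (reverse (α-closed (Partner.live p)) ps)
    (subst (λ y → Partner (inj₁ y) h) (sym (α-involutive x)) (partner-sym h∈ p))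

  path-end : ∀ {h y y′} → Path h (inj₂ y) → Path h (inj₂ y′) → y ≡ y′
  path-end (last p) (last p′) = Sum.inj₂-injective (partner-functional p p′)
  path-end (last p) (p′ ▸ _) with partner-functional p p′
  ... | ()
  path-end (p ▸ _) (last p′) with partner-functional p p′
  ... | ()
  path-end (p ▸ ps) (p′ ▸ ps′) with refl ← partner-functional p p′ = path-end ps ps′

  chain-path : ∀ {h y C} → Chain h (just y) C → Path h (inj₂ y)
  chain-path (reach p)   = last p
  chain-path (cross p c) = p ▸ chain-path c

  module Swapped (e : Y) where

    C : List (X ⊎ Y)
    C = proj₁ (proj₂ (chain e))

    isChain : Chain (inj₂ e) (proj₁ (chain e)) C
    isChain = proj₂ (proj₂ (chain e))

    col′ : X ⊎ Y → Colour r
    col′ h with h ∈? C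
    ... | yes _ = τ (col h)
    ... | no _  = col h

    col′-∈ : ∀ {h} → h ∈ C → col′ h ≡ τ (col h)
    col′-∈ {h} h∈ with h ∈? C
    ... | yes _ = refl
    ... | no h∉ = ⊥-elim (h∉ h∈)

    col′-∉ : ∀ {h} → h ∉ C → col′ h ≡ col h
    col′-∉ {h} h∉ with h ∈? C
    ... | yes h∈ = ⊥-elim (h∉ h∈)
    ... | no _   = refl

    closed : ∀ {h h′} → h ∈ C → h′ ∉ C → h′ ∈ hs → at h ≡ at h′ → τ (col h) ≢ col h′
    closed h∈ h′∉ h′∈hs at≡ col≡ = h′∉ (chain-partner (pendant e) isChain h∈
      (partner h′∈hs (λ { refl → h′∉ h∈ }) (sym at≡) (sym col≡)))

    α-∈ : ∀ {x} → inj₁ x ∈ C → inj₁ (α x) ∈ C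
    α-∈ x∈ with chain-α isChain x∈
    ... | inj₁ αx∈ = αx∈

    result : Colouring r
    result = record { col = col′ ; proper = proper′ ; signed = signed′ }
      where
      proper′ : ∀ {h h′} → h ∈ hs → h′ ∈ hs → at h ≡ at h′ → col′ h ≡ col′ h′ → h ≡ h′
      proper′ {h} {h′} h∈ h′∈ at≡ col≡ with h ∈? C | h′ ∈? C
      ... | yes _   | yes _   = proper h∈ h′∈ at≡ (injective col≡)
      ... | yes h∈C | no h′∉C = ⊥-elim (closed h∈C h′∉C h′∈ at≡ col≡)
      ... | no h∉C  | yes h′∈C = ⊥-elim (closed h′∈C h∉C h∈ (sym at≡) (sym col≡))
      ... | no _    | no _    = proper h∈ h′∈ at≡ col≡

      signed′ : ∀ {x} → inj₁ x ∈ hs → col′ (inj₁ x) ≡ sign x · col′ (inj₁ (α x))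
      signed′ {x} x∈ with inj₁ x ∈? C
      ... | yes x∈C = trans (cong τ (signed x∈)) (trans (equivariant (sign x) _)
                        (cong (sign x ·_) (sym (col′-∈ (α-∈ x∈C)))))
      ... | no x∉C  = trans (signed x∈) (cong (sign x ·_) (sym (col′-∉
                        λ αx∈C → x∉C (subst (λ y → inj₁ y ∈ C) (α-involutive x) (α-∈ αx∈C)))))

  kempeSwap : ∀ (s : Y → Sign) → KempeSwap (λ S z → s z · Colouring.col S (inj₂ z)) S τ
  kempeSwap s = record
    { partner           = λ e → proj₁ (chain e)
    -- Read backwards, both chains start at `z`, and the walk from `z` is determined until it meets
    -- a pendant half-edge.
    ; partner-injective = λ {x} {y} {z} px py → path-end (path-to x px) (path-to y py)
    ; result            = Swapped.result
    ; swapped           = λ x z hit → trans (cong (s z ·_) (Swapped.col′-∈ x (on-chain x z hit))) (sym (equivariant (s z) _))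
    ; fixed             = λ x z z≢x p≢z → cong (s z ·_) (Swapped.col′-∉ x λ z∈ →
                            Sum.[ z≢x ∘ Sum.inj₂-injective , p≢z ] (chain-ends (Swapped.isChain x) z∈))
    }
    where
    path-to : ∀ x {z} → proj₁ (chain x) ≡ just z → Path (inj₂ z) (inj₂ x)
    path-to x p≡ = reverse (pendant x) (chain-path (subst (λ e → Chain (inj₂ x) e (Swapped.C x)) p≡ (Swapped.isChain x)))

    on-chain : ∀ x z → z ≡ x ⊎ proj₁ (chain x) ≡ just z → inj₂ z ∈ Swapped.C x
    on-chain x z (inj₁ refl) = start∈ (Swapped.isChain x)
    on-chain x z (inj₂ p≡)   = chain-end∈ (subst (λ e → Chain (inj₂ x) e (Swapped.C x)) p≡ (Swapped.isChain x))

-- Inserting a vertex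

both : ∀ {A : Set} → List A → List (A × Fin 2)
both xs = cartesianProduct xs (allFin 2)

∑-both : ∀ {A : Set} (xs : List A) {f : A × Fin 2 → ℕ} →
         ∑ (both xs) f ≡ ∑ xs (λ x → f (x , 0F) + f (x , 1F))
∑-both []           = refl
∑-both (x ∷ xs) {f} = trans (cong (λ n → f (x , 0F) + (f (x , 1F) + n)) (∑-both xs))
                            (sym (ℕ.+-assoc (f (x , 0F)) _ _))

ends-both : ∀ {A : Set} (xs : List A) → ends (map (λ x → (x , 0F) , (x , 1F)) xs) ≡ both xs
ends-both []       = refl
ends-both (x ∷ xs) = cong (λ es → (x , 0F) ∷ (x , 1F) ∷ es) (ends-both xs)

∑-map : ∀ {A B : Set} (g : A → B) (xs : List A) {f : B → ℕ} → ∑ (map g xs) f ≡ ∑ xs (f ∘ g)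
∑-map g xs = cong sum (sym (map-∘ xs))

∑-lookup : ∀ {A : Set} (xs : List A) {f : A → ℕ} → ∑ (allFin (length xs)) (f ∘ lookup xs) ≡ ∑ xs f
∑-lookup xs {f} = trans (sym (∑-map (lookup xs) (allFin (length xs))))
  (cong (λ ys → ∑ ys f) (trans (map-tabulate (λ i → i) (lookup xs)) (tabulate-lookup xs)))

allColours : ∀ r → List (Colour r)
allColours r = cartesianProduct (allFin r) (Sign.+ ∷ Sign.- ∷ [])

length-allColours : ∀ r → length (allColours r) ≡ 2 * r
length-allColours r = trans (eq (allFin r)) (trans (cong (_* 2) (length-tabulate (λ (m : Fin r) → m))) (ℕ.*-comm r 2))
  where
  eq : ∀ (ms : List (Fin r)) → length (cartesianProduct ms (Sign.+ ∷ Sign.- ∷ [])) ≡ length ms * 2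
  eq []       = refl
  eq (_ ∷ ms) = cong (2 +_) (eq ms)

unused-colour : ∀ {r} (cs : List (Colour r)) → length cs < 2 * r → ∃ λ c → c ∉ cs
unused-colour {r} cs few with Any.any? (λ c → ¬? (Any.any? (c ≟ᶜ_) cs)) (allColours r)
... | yes unused = let c , _ , c∉ = find unused in c , c∉
... | no ¬unused = ⊥-elim (ℕ.<⇒≱ few (subst (_≤ length cs) (length-allColours r)
        (unique-length (Unique.cartesianProduct⁺ (Unique.allFin⁺ r) (((λ ()) All.∷ All.[]) ∷ All.[] ∷ []))
          λ {c} c∈ → decidable-stable (Any.any? (c ≟ᶜ_) cs) (¬unused ∘ lose c∈))))

flip-≢ : (i : Fin 2) → flip i ≢ i
flip-≢ 0F ()
flip-≢ 1F ()

≢⇒flip : {i j : Fin 2} → i ≢ j → i ≡ flip j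
≢⇒flip {0F} {0F} i≢j = ⊥-elim (i≢j refl)
≢⇒flip {0F} {1F} i≢j = refl
≢⇒flip {1F} {0F} i≢j = refl
≢⇒flip {1F} {1F} i≢j = ⊥-elim (i≢j refl)

module Insertion (Σ : SignedMultigraph) where
  open SignedMultigraph Σ

  other : HalfEdge → HalfEdge
  other (e , i) = e , flip i

  other-involutive : ∀ h → other (other h) ≡ h
  other-involutive (e , i) = cong (e ,_) (Fin.opposite-involutive i)

  at-other : ∀ e i → end e i ≢ end e (flip i)
  at-other e 0F = loopless e
  at-other e 1F = loopless e ∘ sym

  same-half : ∀ e {i j} → end e i ≡ end e j → i ≡ j
  same-half e {i} {j} eq with i Fin.≟ j
  ... | yes i≡j = i≡j
  ... | no i≢j  = ⊥-elim (at-other e j (trans (sym eq) (cong (end e) (≢⇒flip i≢j))))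

  deg : List Edge → Vertex → ℕ
  deg F v = ∑ F λ e → 𝟙 (incident? v e)

  record PartialColouring (r : ℕ) (F : List Edge) : Set where
    field
      col    : HalfEdge → Colour r
      proper : ∀ {h h′} → proj₁ h ∈ F → proj₁ h′ ∈ F → at h ≡ at h′ → col h ≡ col h′ → h ≡ h′
      signed : ∀ {h} → proj₁ h ∈ F → col h ≡ opposite (σ (proj₁ h)) · col (other h)

  partialColouring-⊆ : ∀ {r F F′} → (∀ {e} → e ∈ F′ → e ∈ F) → PartialColouring r F → PartialColouring r F′
  partialColouring-⊆ F′⊆F γ = record
    { col = col ; proper = λ h∈ h′∈ → proper (F′⊆F h∈) (F′⊆F h′∈) ; signed = signed ∘ F′⊆F }
    where open PartialColouring γ

  nearEnd : Vertex → Edge → Fin 2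
  nearEnd u e = if does (end e 0F Fin.≟ u) then 0F else 1F

  farEnd : Vertex → Edge → Vertex
  farEnd u e = end e (flip (nearEnd u e))

  at-near : ∀ {u e} → Incident u e → end e (nearEnd u e) ≡ u
  at-near {u} {e} inc with end e 0F Fin.≟ u
  ... | yes ≡u = ≡u
  ... | no ≢u  = Sum.[ (λ ≡u → ⊥-elim (≢u ≡u)) , (λ ≡u → ≡u) ] inc

  far-incident : ∀ u e → Incident (farEnd u e) e
  far-incident u e with flip (nearEnd u e)
  ... | 0F = inj₁ refl
  ... | 1F = inj₂ refl

  module _ {r} (u : Vertex) (T F : List Edge) (T-at : ∀ {e} → e ∈ T → Incident u e)
           (F-off : ∀ {e} → e ∈ F → ¬ Incident u e) (|T|≤ : length T ≤ 2 * r) where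

    private
      near : Edge → Fin 2
      near = nearEnd u

      far : Edge → Vertex
      far = farEnd u

      Token : Set
      Token = Fin (length T)

      edge : Token → Edge
      edge = lookup T

      Pendant : Set
      Pendant = Token × Fin 2

    -- Each edge of T is represented by two pendant half-edges at its far end.
    graph : List Pendant → HalfEdges
    graph ps = record
      { X = HalfEdge ; Y = Pendant ; V = Vertex
      ; _≟ˣ_ = ≡-dec Fin._≟_ Fin._≟_ ; _≟ʸ_ = ≡-dec Fin._≟_ Fin._≟_ ; _≟ⱽ_ = Fin._≟_
      ; α = other ; α-involutive = other-involutive ; sign = λ (e , _) → opposite (σ e)
      ; at = position ; hs = halves
      ; α-closed = α-closed
      }
      where
      position : HalfEdge ⊎ Pendant → Vertex
      position (inj₁ h)       = at h
      position (inj₂ (t , _)) = far (edge t)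

      halves : List (HalfEdge ⊎ Pendant)
      halves = map inj₂ ps ++ map inj₁ (both F)

      α-closed : ∀ {h} → inj₁ h ∈ halves → inj₁ (other h) ∈ halves
      α-closed h∈ with ∈-++⁻ (map inj₂ ps) h∈
      ... | inj₁ h∈ps with _ , _ , () ← ∈-map⁻ inj₂ h∈ps
      ... | inj₂ h∈F with (e , i) , e∈ , refl ← ∈-map⁻ inj₁ h∈F =
        ∈-++⁺ʳ (map inj₂ ps) (∈-map⁺ inj₁ (∈-cartesianProduct⁺ (proj₁ (∈-cartesianProduct⁻ F (allFin 2) e∈)) (∈-allFin _)))

    module G ps = HalfEdges (graph ps)

    edge∈ : ∀ ps {e i} → inj₁ (e , i) ∈ G.hs ps → e ∈ F
    edge∈ ps h∈ with ∈-++⁻ (map inj₂ ps) h∈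
    ... | inj₁ h∈ps with _ , _ , () ← ∈-map⁻ inj₂ h∈ps
    ... | inj₂ h∈F with _ , e∈ , refl ← ∈-map⁻ inj₁ h∈F = proj₁ (∈-cartesianProduct⁻ F (allFin 2) e∈)

    ∈-edge : ∀ ps {e i} → e ∈ F → inj₁ (e , i) ∈ G.hs ps
    ∈-edge ps e∈ = ∈-++⁺ʳ (map inj₂ ps) (∈-map⁺ inj₁ (∈-cartesianProduct⁺ e∈ (∈-allFin _)))

    -- A pendant half-edge has no edge condition and need only avoid the colours at its vertex. The
    -- count includes the pendant itself, so fewer than `2 * r` colours are taken.
    greedy : ∀ ps → Unique ps → (∀ {x} → x ∈ ps → ∑ (G.hs ps) (λ h → 𝟙 (G.at ps h Fin.≟ G.at ps (inj₂ x))) ≤ 2 * r) →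
             PartialColouring r F → G.Colouring ps r
    greedy [] _ _ γ = record
      -- No pendant is live yet, so its colour is a mere placeholder.
      { col    = λ { (inj₁ h) → col h ; (inj₂ (t , _)) → col (edge t , 0F) }
      ; proper = λ { {inj₁ h} {inj₁ h′} h∈ h′∈ at≡ col≡ → cong inj₁ (proper (edge∈ [] h∈) (edge∈ [] h′∈) at≡ col≡)
                   ; {inj₂ _} h∈ → ⊥-elim (no-pendant h∈)
                   ; {inj₁ _} {inj₂ _} _ h′∈ → ⊥-elim (no-pendant h′∈) }
      ; signed = λ h∈ → signed (edge∈ [] h∈)
      }
      where
      open PartialColouring γ
      no-pendant : ∀ {x} → inj₂ x ∉ G.hs []
      no-pendant x∈ with _ , _ , () ← ∈-map⁻ inj₁ x∈
    greedy (x ∷ ps) uniq@(_ ∷ uniq-ps) room γ = extend (unused-colour (map col (filter near-x? (G.hs ps))) few)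
      where
      rest : G.Colouring ps r
      rest = greedy ps uniq-ps (λ y∈ → ℕ.≤-trans (ℕ.m≤n+m _ _) (room (there y∈))) γ
      open G.Colouring ps rest

      here-x : Vertex
      here-x = G.at ps (inj₂ x)

      near-x? : ∀ h → Dec (G.at ps h ≡ here-x)
      near-x? h = G.at ps h Fin.≟ here-x

      few : length (map col (filter near-x? (G.hs ps))) < 2 * r
      few = ℕ.≤-trans (ℕ.≤-reflexive (cong suc (trans (length-map col (filter near-x? (G.hs ps)))
                                                     (length-filter≡∑ near-x? (G.hs ps)))))
                      (subst (_≤ 2 * r) (cong (_+ ∑ (G.hs ps) (λ h → 𝟙 (near-x? h))) (𝟙-yes (here-x Fin.≟ here-x) refl))
                             (room (here refl)))

      x∉ : inj₂ x ∉ G.hs ps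
      x∉ x∈ with ∈-++⁻ (map inj₂ ps) x∈
      ... | inj₁ x∈ps with _ , x∈′ , refl ← ∈-map⁻ inj₂ x∈ps = Unique[x∷xs]⇒x∉xs uniq x∈′
      ... | inj₂ x∈F with _ , _ , () ← ∈-map⁻ inj₁ x∈F

      extend : (∃ λ c → c ∉ map col (filter near-x? (G.hs ps))) → G.Colouring (x ∷ ps) r
      extend (c , c∉) = record { col = col′ ; proper = proper′ ; signed = λ { (there h∈) → signed h∈ } }
        where
        col′ : HalfEdge ⊎ Pendant → Colour r
        col′ (inj₁ h) = col (inj₁ h)
        col′ (inj₂ y) = if does (G._≟ʸ_ ps y x) then c else col (inj₂ y)

        col′-x : col′ (inj₂ x) ≡ c
        col′-x with G._≟ʸ_ ps x x
        ... | yes _  = refl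
        ... | no x≢x = ⊥-elim (x≢x refl)

        col′-old : ∀ {h} → h ∈ G.hs ps → col′ h ≡ col h
        col′-old {inj₁ _} _ = refl
        col′-old {inj₂ y} y∈ with G._≟ʸ_ ps y x
        ... | yes refl = ⊥-elim (x∉ y∈)
        ... | no _     = refl

        fresh : ∀ {h} → h ∈ G.hs ps → G.at ps h ≡ here-x → col h ≢ c
        fresh h∈ at≡ refl = c∉ (∈-map⁺ col (∈-filter⁺ near-x? h∈ at≡))

        proper′ : ∀ {h h′} → h ∈ inj₂ x ∷ G.hs ps → h′ ∈ inj₂ x ∷ G.hs ps → G.at ps h ≡ G.at ps h′ → col′ h ≡ col′ h′ → h ≡ h′
        proper′ (here refl) (here refl) _ _ = refl
        proper′ (here refl) (there h′∈) at≡ col≡ =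
          ⊥-elim (fresh h′∈ (sym at≡) (trans (sym (col′-old h′∈)) (trans (sym col≡) col′-x)))
        proper′ (there h∈) (here refl) at≡ col≡ =
          ⊥-elim (fresh h∈ at≡ (trans (sym (col′-old h∈)) (trans col≡ col′-x)))
        proper′ (there h∈) (there h′∈) at≡ col≡ =
          proper h∈ h′∈ at≡ (trans (sym (col′-old h∈)) (trans col≡ (col′-old h′∈)))
    -- The game keeps one of the two pendants of each edge: its colour goes to the far half-edge and
    -- its label to the half-edge at `u`. Distinct labels make the colouring proper at `u`, where no
    -- edge of `F` ends.
    insert : (∀ {e} → e ∈ T → deg F (farEnd u e) + 2 * deg T (farEnd u e) ≤ 2 * r) →
             PartialColouring r F → PartialColouring r (T ++ F)
    insert room γ = record { col = col⁺ ; proper = proper⁺ ; signed = signed⁺ }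
      where
      tokens : List Token
      tokens = allFin (length T)

      pendants : List Pendant
      pendants = both tokens

      pendants-unique : Unique pendants
      pendants-unique = Unique.cartesianProduct⁺ (Unique.allFin⁺ (length T)) (Unique.allFin⁺ 2)

      module P = G pendants

      pendant∈ : ∀ x → inj₂ x ∈ P.hs
      pendant∈ (t , j) = ∈-++⁺ˡ (∈-map⁺ inj₂ (∈-cartesianProduct⁺ (∈-allFin t) (∈-allFin j)))

      halves-at : ∀ w → ∑ P.hs (λ h → 𝟙 (P.at h Fin.≟ w)) ≤ deg F w + 2 * deg T w
      halves-at w = begin
        ∑ P.hs at-w                                                   ≡⟨ ∑-++ (map inj₂ pendants) ⟩
        ∑ (map inj₂ pendants) at-w + ∑ (map inj₁ (both F)) at-w       ≡⟨ cong₂ _+_ (∑-map inj₂ pendants) (∑-map inj₁ (both F)) ⟩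
        ∑ pendants (at-w ∘ inj₂) + ∑ (both F) (at-w ∘ inj₁)           ≡⟨ cong₂ _+_ (∑-both tokens) (∑-both F) ⟩
        ∑ tokens (λ t → far-at (edge t) + far-at (edge t)) + ∑ F ends-at ≡⟨ cong (_+ ∑ F ends-at) (∑-lookup T {λ e → far-at e + far-at e}) ⟩
        ∑ T (λ e → far-at e + far-at e) + ∑ F ends-at                 ≡⟨ cong (_+ ∑ F ends-at) (∑-+ T) ⟩
        (∑ T far-at + ∑ T far-at) + ∑ F ends-at                       ≤⟨ ℕ.+-mono-≤ (ℕ.+-mono-≤ T≤ T≤) (∑-mono F (λ {e} _ → ends≤ e)) ⟩
        (deg T w + deg T w) + deg F w                                 ≡⟨ cong (λ n → (deg T w + n) + deg F w) (ℕ.+-identityʳ (deg T w)) ⟨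
        2 * deg T w + deg F w                                         ≡⟨ ℕ.+-comm (2 * deg T w) (deg F w) ⟩
        deg F w + 2 * deg T w                                         ∎
        where
        open ℕ.≤-Reasoning
        at-w : HalfEdge ⊎ Pendant → ℕ
        at-w h = 𝟙 (P.at h Fin.≟ w)
        far-at : Edge → ℕ
        far-at e = 𝟙 (far e Fin.≟ w)
        ends-at : Edge → ℕ
        ends-at e = 𝟙 (end e 0F Fin.≟ w) + 𝟙 (end e 1F Fin.≟ w)
        T≤ : ∑ T far-at ≤ deg T w
        T≤ = ∑-mono T λ {e} _ → 𝟙-mono (far e Fin.≟ w) (incident? w e) λ { refl → far-incident u e }
        ends≤ : ∀ e → ends-at e ≤ 𝟙 (incident? w e)
        ends≤ e with end e 0F Fin.≟ w | end e 1F Fin.≟ w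
        ... | yes ≡w | yes ≡w′ = ⊥-elim (loopless e (trans ≡w (sym ≡w′)))
        ... | yes ≡w | no _    = ℕ.≤-refl
        ... | no _   | yes ≡w′ = ℕ.≤-refl
        ... | no _   | no _    = z≤n

      start : P.Colouring r
      start = greedy pendants pendants-unique
        (λ {x} _ → ℕ.≤-trans (halves-at (far (edge (proj₁ x)))) (room (∈-lookup (proj₁ x)))) γ

      sgn : Edge → Sign
      sgn e = opposite (σ e)

      label : P.Colouring r → Pendant → Colour r
      label S x = sgn (edge (proj₁ x)) · P.Colouring.col S (inj₂ x)

      open Game P._≟ʸ_ label
        (λ S isSwap → KempeChain.kempeSwap (graph pendants) pendant∈ S isSwap (sgn ∘ edge ∘ proj₁)) using (Solved; solve)

      pairs : List (Pendant × Pendant)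
      pairs = map (λ t → (t , 0F) , (t , 1F)) tokens

      abstract
        solved : Solved start (allFin r) pairs
        solved = solve r
          (record { uniqueAct  = Unique.allFin⁺ r
                  ; uniqueEnds = subst Unique (sym (ends-both tokens)) pendants-unique
                  ; active     = λ _ → ∈-allFin _ })
          (length-tabulate (λ (m : Fin r) → m))
          (subst (_≤ 2 * r) (sym (trans (length-map _ tokens) (length-tabulate (λ (t : Token) → t)))) |T|≤)

      S : P.Colouring r
      S = proj₁ solved

      open SDR (proj₂ (proj₂ solved)) renaming (injective to chosen-injective)
      open P.Colouring S using (col; proper; signed)

      chosen-end : ∀ t → ∃ λ j → (t , j) ∈ chosen
      chosen-end t with hits (∈-map⁺ _ (∈-allFin t))
      ... | inj₁ t∈ = 0F , t∈
      ... | inj₂ t∈ = 1F , t∈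

      rep : Token → Pendant
      rep t = t , proj₁ (chosen-end t)

      col-T : Edge → Token → Fin 2 → Colour r
      col-T e t i with i Fin.≟ near e
      ... | yes _ = label S (rep t)
      ... | no _  = col (inj₂ (rep t))

      token : ∀ {e} → e ∈ T → Token
      token = Any.index

      edge-token : ∀ {e} (e∈ : e ∈ T) → edge (token e∈) ≡ e
      edge-token e∈ = sym (lookup-index e∈)

      _∈T? : ∀ e → Dec (e ∈ T)
      e ∈T? = Any.any? (e Fin.≟_) T

      col⁺ : HalfEdge → Colour r
      col⁺ (e , i) with e ∈T?
      ... | yes e∈ = col-T e (token e∈) i
      ... | no _   = col (inj₁ (e , i))

      in-F : ∀ {e} → e ∈ T ++ F → e ∉ T → e ∈ F
      in-F e∈ e∉T = Sum.[ (λ e∈T → ⊥-elim (e∉T e∈T)) , (λ e∈F → e∈F) ] (∈-++⁻ T e∈)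

      at-far : ∀ {e i} (e∈ : e ∈ T) → i ≢ near e → end e i ≡ P.at (inj₂ (rep (token e∈)))
      at-far {e} e∈ i≢ = trans (cong (end e) (≢⇒flip i≢)) (cong far (sym (edge-token e∈)))

      same-edge : ∀ {e e′ i i′} → e ≡ e′ → end e i ≡ end e′ i′ → (e , i) ≡ (e′ , i′)
      same-edge {e} refl at≡ = cong (e ,_) (same-half e at≡)

      same-token : ∀ {e e′} (e∈ : e ∈ T) (e′∈ : e′ ∈ T) → rep (token e∈) ≡ rep (token e′∈) → e ≡ e′
      same-token e∈ e′∈ eq = trans (sym (edge-token e∈)) (trans (cong (edge ∘ proj₁) eq) (edge-token e′∈))

      at-u : ∀ {e i} → e ∈ T → i ≡ near e → end e i ≡ u
      at-u e∈ refl = at-near (T-at e∈)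

      not-u : ∀ {e i} → e ∈ T → i ≢ near e → end e i ≢ u
      not-u {e} e∈ i≢ ≡u = i≢ (same-half e (trans ≡u (sym (at-near (T-at e∈)))))

      F-not-u : ∀ {e i} → e ∈ F → end e i ≢ u
      F-not-u {i = 0F} e∈ = F-off e∈ ∘ inj₁
      F-not-u {i = 1F} e∈ = F-off e∈ ∘ inj₂

      mixed : ∀ {e i e′ i′} (e∈ : e ∈ T) → e′ ∈ F → end e i ≡ end e′ i′ → col-T e (token e∈) i ≢ col (inj₁ (e′ , i′))
      mixed {e} {i} e∈ e′∈ at≡ col≡ with i Fin.≟ near e
      ... | yes ≡near = F-not-u e′∈ (trans (sym at≡) (at-u e∈ ≡near))
      ... | no ≢near with proper (pendant∈ (rep (token e∈))) (∈-edge pendants e′∈) (trans (sym (at-far e∈ ≢near)) at≡) col≡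
      ...   | ()

      proper⁺ : ∀ {h h′} → proj₁ h ∈ T ++ F → proj₁ h′ ∈ T ++ F → at h ≡ at h′ → col⁺ h ≡ col⁺ h′ → h ≡ h′
      proper⁺ {e , i} {e′ , i′} h∈ h′∈ at≡ col≡ with e ∈T? | e′ ∈T?
      ... | no e∉  | no e′∉  = Sum.inj₁-injective (proper (∈-edge pendants (in-F h∈ e∉)) (∈-edge pendants (in-F h′∈ e′∉)) at≡ col≡)
      ... | yes e∈ | no e′∉  = ⊥-elim (mixed e∈ (in-F h′∈ e′∉) at≡ col≡)
      ... | no e∉  | yes e′∈ = ⊥-elim (mixed e′∈ (in-F h∈ e∉) (sym at≡) (sym col≡))
      ... | yes e∈ | yes e′∈ with i Fin.≟ near e | i′ Fin.≟ near e′
      ...   | yes n | yes n′ = same-edge (same-token e∈ e′∈ (chosen-injective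
                (proj₂ (chosen-end (token e∈))) (proj₂ (chosen-end (token e′∈))) col≡)) at≡
      ...   | no n  | no n′  = same-edge (same-token e∈ e′∈ (Sum.inj₂-injective (proper (pendant∈ _) (pendant∈ _)
                (trans (sym (at-far e∈ n)) (trans at≡ (at-far e′∈ n′))) col≡))) at≡
      ...   | yes n | no n′  = ⊥-elim (not-u e′∈ n′ (trans (sym at≡) (at-u e∈ n)))
      ...   | no n  | yes n′ = ⊥-elim (not-u e∈ n (trans at≡ (at-u e′∈ n′)))

      signed⁺ : ∀ {h} → proj₁ h ∈ T ++ F → col⁺ h ≡ sgn (proj₁ h) · col⁺ (other h)
      signed⁺ {e , i} h∈ with e ∈T?
      ... | no e∉  = signed (∈-edge pendants (in-F h∈ e∉))
      ... | yes e∈ with i Fin.≟ near e | flip i Fin.≟ near e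
      ...   | yes n | yes n′ = ⊥-elim (flip-≢ i (trans n′ (sym n)))
      ...   | no n  | no n′  = ⊥-elim (n′ (trans (cong flip (≢⇒flip n)) (Fin.opposite-involutive (near e))))
      ...   | yes n | no n′  = cong (λ e → sgn e · col (inj₂ (rep (token e∈)))) (edge-token e∈)
      ...   | no n  | yes n′ = trans (sym (·-involutive (sgn e) _))
                (cong (λ e′ → sgn e · sgn e′ · col (inj₂ (rep (token e∈)))) (sym (edge-token e∈)))

-- Edge counts and the translation into integer colours

𝟙-disjoint : ∀ {A B I : Set} (A? : Dec A) (B? : Dec B) (I? : Dec I) → (A → ¬ B) →
             𝟙 A? * 𝟙 I? + 𝟙 B? * 𝟙 I? ≤ 𝟙 I?
𝟙-disjoint (yes a) (yes b) I? disjoint = ⊥-elim (disjoint a b)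
𝟙-disjoint (yes _) (no _)  I? _ = ℕ.≤-reflexive (trans (ℕ.+-identityʳ _) (ℕ.+-identityʳ _))
𝟙-disjoint (no _)  (yes _) I? _ = ℕ.≤-reflexive (ℕ.+-identityʳ _)
𝟙-disjoint (no _)  (no _)  I? _ = z≤n

𝟙-* : ∀ {A I J : Set} (A? : Dec A) (I? : Dec I) (J? : Dec J) → (A → I → J) → 𝟙 A? * 𝟙 I? ≤ 𝟙 J?
𝟙-* (yes a) (yes i) J? f = ℕ.≤-reflexive (sym (𝟙-yes J? (f a i)))
𝟙-* (yes _) (no _)  J? f = z≤n
𝟙-* (no _)  _       J? f = z≤n

count≡∑ : ∀ {A : Set} {P : Pred A 0ℓ} (P? : Decidable P) {n} (f : Fin n → A) →
          Vec.count P? (Vec.tabulate f) ≡ ∑ (List.tabulate f) (λ x → 𝟙 (P? x))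
count≡∑ P? {zero}  f = refl
count≡∑ P? {suc n} f with does (P? (f Fin.zero))
... | true  = cong suc (count≡∑ P? (f ∘ Fin.suc))
... | false = count≡∑ P? (f ∘ Fin.suc)

even-or-odd : ∀ k → ∃ λ r → k ≡ 2 * r ⊎ k ≡ 2 * r + 1
even-or-odd zero    = 0 , inj₁ refl
even-or-odd (suc k) with even-or-odd k
... | r , inj₁ refl = r , inj₂ (ℕ.+-comm 1 (2 * r))
... | r , inj₂ refl = suc r , inj₁ (trans (cong suc (ℕ.+-comm (2 * r) 1)) (sym (ℕ.*-suc 2 r)))

module _ {r : ℕ} where

  toℤ : Colour r → ℤ
  toℤ (m , s) = s ◃ suc (toℕ m)

  toℤ-injective : ∀ c d → toℤ c ≡ toℤ d → c ≡ d
  toℤ-injective (m , Sign.+) (n , Sign.+) eq =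
    cong (_, Sign.+) (Fin.toℕ-injective (ℕ.suc-injective (ℤ.+-injective eq)))
  toℤ-injective (m , Sign.-) (n , Sign.-) eq =
    cong (_, Sign.-) (Fin.toℕ-injective (ℤ.-[1+-injective eq))

  toℤ≢0 : ∀ c → toℤ c ≢ 0ℤ
  toℤ≢0 (m , Sign.+) ()
  toℤ≢0 (m , Sign.-) ()

  toℤ-opposite : ∀ s c → toℤ (opposite s · c) ≡ - ((s ◃ 1) ℤ.* toℤ c)
  toℤ-opposite Sign.+ c@(m , Sign.+) = cong -_ (sym (ℤ.*-identityˡ (toℤ c)))
  toℤ-opposite Sign.+ c@(m , Sign.-) = cong -_ (sym (ℤ.*-identityˡ (toℤ c)))
  toℤ-opposite Sign.- c@(m , Sign.+) = cong -_ (sym (ℤ.-1*i≡-i (toℤ c)))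
  toℤ-opposite Sign.- c@(m , Sign.-) = cong -_ (sym (ℤ.-1*i≡-i (toℤ c)))

  toℤ-bounds : ∀ c → (- (ℤ.+ r) ℤ.≤ toℤ c × toℤ c ℤ.≤ -1ℤ) ⊎ (1ℤ ℤ.≤ toℤ c × toℤ c ℤ.≤ ℤ.+ r)
  toℤ-bounds (m , Sign.+) = inj₂ (+≤+ (s≤s z≤n) , +≤+ (Fin.toℕ<n m))
  toℤ-bounds (m , Sign.-) = inj₁ (ℤ.neg-mono-≤ (+≤+ (Fin.toℕ<n m)) , -≤- z≤n)

  toℤ-even : ∀ c → toℤ c ∈M (2 * r)
  toℤ-even c = inj₁ (r , refl , toℤ-bounds c)

  toℤ-odd : ∀ c → toℤ c ∈M (2 * r + 1)
  toℤ-odd c with toℤ-bounds c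
  ... | inj₁ (lo , hi) = inj₂ (r , refl , lo , ℤ.≤-trans hi -≤+)
  ... | inj₂ (lo , hi) = inj₂ (r , refl , ℤ.≤-trans (ℤ.neg-≤-pos {r} {1}) lo , hi)

  0-odd : 0ℤ ∈M (2 * r + 1)
  0-odd = inj₂ (r , refl , ℤ.neg-≤-pos {r} {0} , +≤+ z≤n)

-- The order of insertion

module Vizing (Σ : SignedMultigraph) where
  open SignedMultigraph Σ
  open Insertion Σ

  mult : List Edge → Vertex → Vertex → ℕ
  mult L u v = ∑ L λ e → 𝟙 (joins? u v e)

  deg-filter : ∀ {P : Pred Edge 0ℓ} (P? : Decidable P) L v → deg (filter P? L) v ≡ ∑ L (λ e → 𝟙 (P? e) * 𝟙 (incident? v e))
  deg-filter P? L v = ∑-filter P? L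

  deg-filter-≤ : ∀ {P : Pred Edge 0ℓ} (P? : Decidable P) L v → deg (filter P? L) v ≤ deg L v
  deg-filter-≤ P? L v = subst (_≤ deg L v) (sym (deg-filter P? L v))
    (∑-mono L λ {e} _ → 𝟙-* (P? e) (incident? v e) (incident? v e) λ _ i → i)

  -- Vertices are inserted one at a time, the small ones first, so that whenever u is inserted its
  -- neighbours present are small and have two colours left for each edge to u.
  module _ {r} (L : List Edge) {Small : Pred Vertex 0ℓ} (small? : Decidable Small) (m : ℕ)
           (small : ∀ v → Small v → deg L v + m ≤ 2 * r)
           (mult≤ : ∀ u v → u ≢ v → mult L u v ≤ m)
           (deg≤  : ∀ v → deg L v ≤ 2 * r)
           (some-small : ∀ {e} → e ∈ L → Small (end e 0F) ⊎ Small (end e 1F))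
           (default : HalfEdge → Colour r) where

    open DecMembership (Fin._≟_ {#V}) using (_∈?_)

    Within : List Vertex → Edge → Set
    Within D e = end e 0F ∈ D × end e 1F ∈ D

    within? : ∀ D → Decidable (Within D)
    within? D e = (end e 0F ∈? D) ×-dec (end e 1F ∈? D)

    Star : Vertex → List Vertex → Edge → Set
    Star u D e = (end e 0F ≡ u × end e 1F ∈ D) ⊎ (end e 1F ≡ u × end e 0F ∈ D)

    star? : ∀ u D → Decidable (Star u D)
    star? u D e = ((end e 0F Fin.≟ u) ×-dec (end e 1F ∈? D)) ⊎-dec ((end e 1F Fin.≟ u) ×-dec (end e 0F ∈? D))

    induced : List Vertex → List Edge
    induced D = filter (within? D) L

    SmallNeighbours : List Vertex → Vertex → Set
    SmallNeighbours D u = ∀ {w e} → w ∈ D → e ∈ L → Joins u w e → Small w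

    add-vertex : ∀ D u → u ∉ D → SmallNeighbours D u → PartialColouring r (induced D) → PartialColouring r (induced (u ∷ D))
    add-vertex D u u∉D small-nbr γ =
      partialColouring-⊆ covers (insert u T (induced D) T-at F-off T≤ room γ)
      where
      T : List Edge
      T = filter (star? u D) L

      star : ∀ {e} → e ∈ T → e ∈ L × Star u D e
      star = ∈-filter⁻ (star? u D)

      T-at : ∀ {e} → e ∈ T → Incident u e
      T-at e∈ = Sum.map proj₁ proj₁ (proj₂ (star e∈))

      F-off : ∀ {e} → e ∈ induced D → ¬ Incident u e
      F-off e∈ (inj₁ refl) = u∉D (proj₁ (proj₂ (∈-filter⁻ (within? D) {xs = L} e∈)))
      F-off e∈ (inj₂ refl) = u∉D (proj₂ (proj₂ (∈-filter⁻ (within? D) {xs = L} e∈)))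

      T≤ : length T ≤ 2 * r
      T≤ = ℕ.≤-trans (ℕ.≤-reflexive (length-filter≡∑ (star? u D) L))
             (ℕ.≤-trans (∑-mono L λ {e} _ → 𝟙-mono (star? u D e) (incident? u e) (Sum.map proj₁ proj₁)) (deg≤ u))

      covers : ∀ {e} → e ∈ induced (u ∷ D) → e ∈ T ++ induced D
      covers {e} e∈ with ∈-filter⁻ (within? (u ∷ D)) {xs = L} e∈
      ... | e∈L , here p   , here q   = ⊥-elim (loopless e (trans p (sym q)))
      ... | e∈L , here p   , there q∈ = ∈-++⁺ˡ (∈-filter⁺ (star? u D) e∈L (inj₁ (p , q∈)))
      ... | e∈L , there p∈ , here q   = ∈-++⁺ˡ (∈-filter⁺ (star? u D) e∈L (inj₂ (q , p∈)))
      ... | e∈L , there p∈ , there q∈ = ∈-++⁺ʳ T (∈-filter⁺ (within? D) e∈L (p∈ , q∈))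

      star-joins : ∀ {w e} → w ≢ u → Star u D e → Incident w e → Joins u w e
      star-joins w≢u (inj₁ (p , _)) (inj₁ refl) = ⊥-elim (w≢u p)
      star-joins w≢u (inj₁ (p , _)) (inj₂ q)    = inj₁ (p , q)
      star-joins w≢u (inj₂ (p , _)) (inj₁ q)    = inj₂ (q , p)
      star-joins w≢u (inj₂ (p , _)) (inj₂ refl) = ⊥-elim (w≢u p)

      joins-∈ : ∀ {w e} → w ≢ u → Star u D e → Incident w e → w ∈ D
      joins-∈ w≢u (inj₁ (p , _))  (inj₁ refl) = ⊥-elim (w≢u p)
      joins-∈ w≢u (inj₁ (_ , q∈)) (inj₂ refl) = q∈
      joins-∈ w≢u (inj₂ (_ , q∈)) (inj₁ refl) = q∈
      joins-∈ w≢u (inj₂ (p , _))  (inj₂ refl) = ⊥-elim (w≢u p)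

      -- The edges from `w` to `D` and those from `w` to `u` are disjoint sets of edges at `w`,
      -- which bounds one copy of `deg T w` by the degree. The other copy counts only edges joining
      -- `w` to `u`, hence at most `m`.
      room : ∀ {e} → e ∈ T → deg (induced D) (farEnd u e) + 2 * deg T (farEnd u e) ≤ 2 * r
      room {e} e∈ = begin
        deg (induced D) w + (deg T w + (deg T w + 0))  ≡⟨ cong (λ n → deg (induced D) w + (deg T w + n)) (ℕ.+-identityʳ _) ⟩
        deg (induced D) w + (deg T w + deg T w)        ≡⟨ ℕ.+-assoc (deg (induced D) w) _ _ ⟨
        (deg (induced D) w + deg T w) + deg T w        ≤⟨ ℕ.+-mono-≤ parts (ℕ.≤-trans to-u (mult≤ u w (w≢u ∘ sym))) ⟩
        deg L w + m                                    ≤⟨ small w (small-nbr (joins-∈ w≢u e-star (far-incident u e)) (proj₁ (star e∈))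
                                                                    (star-joins w≢u e-star (far-incident u e))) ⟩
        2 * r                                          ∎
        where
        open ℕ.≤-Reasoning
        w : Vertex
        w = farEnd u e
        e-star : Star u D e
        e-star = proj₂ (star e∈)
        w≢u : w ≢ u
        w≢u w≡u = flip-≢ (nearEnd u e) (same-half e (trans w≡u (sym (at-near (T-at e∈)))))
        exclusive : ∀ {e} → Within D e → ¬ Star u D e
        exclusive (p∈ , _) (inj₁ (refl , _)) = u∉D p∈
        exclusive (_ , q∈) (inj₂ (refl , _)) = u∉D q∈
        parts : deg (induced D) w + deg T w ≤ deg L w
        parts = subst (_≤ deg L w) (trans (∑-+ L) (cong₂ _+_ (sym (deg-filter (within? D) L w)) (sym (deg-filter (star? u D) L w))))
          (∑-mono L λ {e} _ → 𝟙-disjoint (within? D e) (star? u D e) (incident? w e) exclusive)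
        to-u : deg T w ≤ mult L u w
        to-u = subst (_≤ mult L u w) (sym (deg-filter (star? u D) L w))
          (∑-mono L λ {e} _ → 𝟙-* (star? u D e) (incident? w e) (joins? u w e) (star-joins w≢u))

    -- `Good` is an invariant of the set of inserted vertices. It is used twice: while all inserted
    -- vertices are small, and once all small vertices are inserted.
    add-vertices : (Good : List Vertex → Set) → (∀ {D u} → Good D → u ∉ D → SmallNeighbours D u) →
                   ∀ vs → (∀ {D v} → v ∈ vs → Good D → Good (v ∷ D)) →
                   ∀ D → Good D → PartialColouring r (induced D) →
                   ∃ λ D′ → Good D′ × (∀ {v} → v ∈ vs → v ∈ D′) × (∀ {v} → v ∈ D → v ∈ D′) × PartialColouring r (induced D′)
    add-vertices Good nbrs []       grow D good γ = D , good , (λ ()) , (λ v∈ → v∈) , γ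
    add-vertices Good nbrs (v ∷ vs) grow D good γ with v ∈? D
    ... | yes v∈ = let D′ , good′ , vs⊆ , D⊆ , γ′ = add-vertices Good nbrs vs (grow ∘ there) D good γ
                   in D′ , good′ , (λ { (here refl) → D⊆ v∈ ; (there w∈) → vs⊆ w∈ }) , D⊆ , γ′
    ... | no v∉  = let D′ , good′ , vs⊆ , D⊆ , γ′ = add-vertices Good nbrs vs (grow ∘ there) (v ∷ D)
                                                      (grow (here refl) good) (add-vertex D v v∉ (nbrs good v∉) γ)
                   in D′ , good′ , (λ { (here refl) → D⊆ (here refl) ; (there w∈) → vs⊆ w∈ }) , D⊆ ∘ there , γ′

    colour-all : PartialColouring r L
    colour-all with add-vertices (λ D → ∀ {w} → w ∈ D → Small w) (λ good _ w∈ _ _ → good w∈)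
                      (filter small? (allFin #V))
                      (λ v∈ good → λ { (here refl) → proj₂ (∈-filter⁻ small? {xs = allFin #V} v∈) ; (there w∈) → good w∈ })
                      [] (λ ()) empty
      where
      empty : PartialColouring r (induced [])
      empty = record { col = default ; proper = λ h∈ → ⊥-elim (none h∈) ; signed = λ h∈ → ⊥-elim (none h∈) }
        where
        none : ∀ {e} → e ∉ induced []
        none e∈ with ∈-filter⁻ (within? []) {xs = L} e∈
        ... | ()
    ... | D₁ , _ , small⊆ , _ , γ₁ with add-vertices (λ D → ∀ {w} → Small w → w ∈ D) nbrs (allFin #V)
                                        (λ _ good → there ∘ good) D₁ (λ {w} s → small⊆ (∈-filter⁺ small? (∈-allFin w) s)) γ₁
      where
      -- A vertex still absent in this phase is not small, so the small end of each of its edges is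
      -- the neighbour.
      nbrs : ∀ {D u} → (∀ {w} → Small w → w ∈ D) → u ∉ D → SmallNeighbours D u
      nbrs good u∉ w∈ e∈ joins with some-small e∈ | joins
      ... | inj₁ s | inj₁ (refl , refl) = ⊥-elim (u∉ (good s))
      ... | inj₂ s | inj₁ (refl , refl) = s
      ... | inj₁ s | inj₂ (refl , refl) = s
      ... | inj₂ s | inj₂ (refl , refl) = ⊥-elim (u∉ (good s))
    ...   | D₂ , _ , all⊆ , _ , γ₂ =
      partialColouring-⊆ (λ e∈ → ∈-filter⁺ (within? D₂) e∈ (all⊆ (∈-allFin _) , all⊆ (∈-allFin _))) γ₂

  -- Colour 0 on a matching

  edges : List Edge
  edges = allFin #E

  Covered : List Edge → Vertex → Set
  Covered M v = Any (Incident v) M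

  covered? : ∀ M → Decidable (Covered M)
  covered? M v = Any.any? (incident? v) M

  record MaximalMatching (es : List Edge) : Set where
    field
      M        : List Edge
      disjoint : ∀ {e e′ i i′} → e ∈ M → e′ ∈ M → end e i ≡ end e′ i′ → e ≡ e′
      maximal  : ∀ {e} → e ∈ es → Covered M (end e 0F) ⊎ Covered M (end e 1F)

  end-incident : ∀ e i → Incident (end e i) e
  end-incident e 0F = inj₁ refl
  end-incident e 1F = inj₂ refl

  maximalMatching : ∀ es → MaximalMatching es
  maximalMatching [] = record { M = [] ; disjoint = λ () ; maximal = λ () }
  maximalMatching (e ∷ es) with maximalMatching es
  ... | record { M = M ; disjoint = disjoint ; maximal = maximal }
    with covered? M (end e 0F) | covered? M (end e 1F)
  ... | yes c | _     = record { M = M ; disjoint = disjoint ; maximal = λ { (here refl) → inj₁ c ; (there e∈) → maximal e∈ } }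
  ... | no _  | yes c = record { M = M ; disjoint = disjoint ; maximal = λ { (here refl) → inj₂ c ; (there e∈) → maximal e∈ } }
  ... | no ¬c | no ¬c′ = record
    { M        = e ∷ M
    ; disjoint = λ { (here refl) (here refl) _ → refl
                   ; {i = i} {i′} (here refl) (there e′∈) eq → ⊥-elim (free i (cover e′∈ (sym eq)))
                   ; {i = i} {i′} (there e∈) (here refl) eq → ⊥-elim (free i′ (cover e∈ eq))
                   ; (there e∈) (there e′∈) eq → disjoint e∈ e′∈ eq }
    ; maximal  = λ { (here refl) → inj₁ (here (inj₁ refl)) ; (there e∈) → Sum.map there there (maximal e∈) }
    }
    where
    free : ∀ i → ¬ Covered M (end e i)
    free 0F = ¬c
    free 1F = ¬c′
    cover : ∀ {e′ i v} → e′ ∈ M → end e′ i ≡ v → Covered M v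
    cover {e′} {i} e′∈ refl = lose e′∈ (end-incident e′ i)

  module _ (M L : List Edge) (M∪L : ∀ e → e ∉ M → e ∈ L)
           (disjoint : ∀ {e e′ i i′} → e ∈ M → e′ ∈ M → end e i ≡ end e′ i′ → e ≡ e′) where

    -- Being its own negative, 0 meets the edge condition for either sign, and it differs from every
    -- `toℤ c`. It has to lie in the palette only if `M` has an edge, so an empty `M` serves the
    -- even palettes.
    colorable : ∀ {r k} → (∀ c → toℤ {r} c ∈M k) → (∀ {e} → e ∈ M → 0ℤ ∈M k) → PartialColouring r L → EdgeColorable Σ k
    colorable {r} {k} toℤ∈ 0∈ col-L = γ , record { inPalette = inPalette ; proper = proper′ ; signed = signed′ }
      where
      open PartialColouring col-L

      matched? : ∀ e → Dec (e ∈ M)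
      matched? e = Any.any? (e Fin.≟_) M

      γ : HalfEdge → ℤ
      γ (e , i) with matched? e
      ... | yes _ = 0ℤ
      ... | no _  = toℤ (col (e , i))

      inPalette : ∀ h → γ h ∈M k
      inPalette (e , i) with matched? e
      ... | yes e∈ = 0∈ e∈
      ... | no _   = toℤ∈ (col (e , i))

      proper′ : ∀ h h′ → at h ≡ at h′ → h ≢ h′ → γ h ≢ γ h′
      proper′ (e , i) (e′ , i′) at≡ h≢h′ γ≡ with matched? e | matched? e′
      ... | yes e∈ | yes e′∈ = h≢h′ (same-edge (disjoint {i = i} {i′} e∈ e′∈ at≡) at≡)
        where
        same-edge : ∀ {e e′ i i′} → e ≡ e′ → end e i ≡ end e′ i′ → (e , i) ≡ (e′ , i′)
        same-edge {e} refl at≡ = cong (e ,_) (same-half e at≡)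
      ... | yes _  | no _    = toℤ≢0 (col (e′ , i′)) (sym γ≡)
      ... | no _   | yes _   = toℤ≢0 (col (e , i)) γ≡
      ... | no e∉  | no e′∉  = h≢h′ (proper (M∪L e e∉) (M∪L e′ e′∉) at≡ (toℤ-injective _ _ γ≡))

      signed′ : ∀ e i → γ (e , i) ≡ - ((σ e ◃ 1) ℤ.* γ (e , flip i))
      signed′ e i with matched? e
      ... | yes _ = sym (cong -_ (ℤ.*-zeroʳ (σ e ◃ 1)))
      ... | no e∉ = trans (cong toℤ (signed (M∪L e e∉))) (toℤ-opposite (σ e) _)

  -- Bounds by maximum degree and multiplicity, and the two parities

  degree≡ : ∀ v → degree v ≡ deg edges v
  degree≡ v = count≡∑ (incident? v) (λ e → e)

  deg≤Δ : ∀ v → deg edges v ≤ Δ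
  deg≤Δ v = subst (_≤ Δ) (degree≡ v) (All.lookup (Extrema.xs≤max 0 _) (∈-map⁺ degree (∈-allFin v)))

  mult≤μ : ∀ u v → u ≢ v → mult edges u v ≤ μ
  mult≤μ u v u≢v = subst (_≤ μ) (count≡∑ (joins? u v) (λ e → e))
    (All.lookup (Extrema.xs≤max 0 _) (∈-map⁺ _ (∈-filter⁺ _ (∈-cartesianProduct⁺ (∈-allFin u) (∈-allFin v)) u≢v)))

  1≤μ : Edge → 1 ≤ μ
  1≤μ e = ℕ.≤-trans (subst (_≤ mult edges (end e 0F) (end e 1F)) (𝟙-yes (joins? _ _ e) (inj₁ (refl , refl)))
                     (∑-member {f = 𝟙 ∘ joins? (end e 0F) (end e 1F)} (∈-allFin e)))
                    (mult≤μ (end e 0F) (end e 1F) (loopless e))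

  1≤Δ : Edge → 1 ≤ Δ
  1≤Δ e = ℕ.≤-trans (subst (_≤ deg edges (end e 0F)) (𝟙-yes (incident? _ e) (inj₁ refl))
                     (∑-member {f = 𝟙 ∘ incident? (end e 0F)} (∈-allFin e)))
                    (deg≤Δ (end e 0F))

  first-colour : ∀ {r} → 2 ≤ 2 * r + 1 → Colour r
  first-colour {zero}  (s≤s ())
  first-colour {suc r} _ = Fin.zero , Sign.+

  -- A half-edge forces both `Δ` and `μ` to be at least 1, hence `r` is positive and a non-zero
  -- colour exists.
  default-colour : ∀ {r} → Δ + μ ≤ 2 * r + 1 → HalfEdge → Colour r
  default-colour {r} bound (e , _) = first-colour {r} (ℕ.≤-trans (ℕ.+-mono-≤ (1≤Δ e) (1≤μ e)) bound)

  colorable-even : ∀ r → Δ + μ ≡ 2 * r → EdgeColorable Σ (2 * r)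
  colorable-even r k≡ = colorable [] edges (λ e _ → ∈-allFin e) (λ ()) toℤ-even (λ ())
    -- With an even palette every vertex counts as small.
    (colour-all edges {λ _ → ⊤} (λ _ → yes tt) μ
      (λ v _ → subst (deg edges v + μ ≤_) k≡ (ℕ.+-monoˡ-≤ μ (deg≤Δ v)))
      mult≤μ
      (λ v → subst (deg edges v ≤_) k≡ (ℕ.≤-trans (deg≤Δ v) (ℕ.m≤m+n Δ μ)))
      (λ _ → inj₁ tt)
      (default-colour {r} (subst (_≤ 2 * r + 1) (sym k≡) (ℕ.m≤m+n _ 1))))

  colorable-odd : ∀ r → Δ + μ ≡ 2 * r + 1 → EdgeColorable Σ (2 * r + 1)
  colorable-odd r k≡ = colorable M L (λ e e∉ → ∈-filter⁺ outside? (∈-allFin e) e∉) disjoint toℤ-odd (λ _ → 0-odd {r})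
    (colour-all L (covered? M) μ saturated
      (λ u v u≢v → ℕ.≤-trans (mult-filter u v) (mult≤μ u v u≢v)) deg≤
      (λ {e} _ → maximal (∈-allFin e)) (default-colour {r} (ℕ.≤-reflexive k≡)))
    where
    open MaximalMatching (maximalMatching edges)

    outside? : Decidable (_∉ M)
    outside? e = ¬? (Any.any? (e Fin.≟_) M)

    L : List Edge
    L = filter outside? edges

    k≡′ : Δ + μ ≡ suc (2 * r)
    k≡′ = trans k≡ (ℕ.+-comm (2 * r) 1)

    mult-filter : ∀ u v → mult L u v ≤ mult edges u v
    mult-filter u v = subst (_≤ mult edges u v) (sym (∑-filter outside? edges))
      (∑-mono edges λ {e} _ → 𝟙-* (outside? e) (joins? u v e) (joins? u v e) λ _ j → j)

    -- The matching edge at `v` is missing from `L`, so the degree of `v` drops by one; this pays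
    -- for the colour 0 withheld from `L`.
    saturated : ∀ v → Covered M v → deg L v + μ ≤ 2 * r
    saturated v cov with e , e∈ , inc ← find cov = ℕ.≤-pred (subst (suc (deg L v + μ) ≤_) k≡′
      (ℕ.+-monoˡ-≤ μ (ℕ.≤-trans less-than-edges (deg≤Δ v))))
      where
      less-than-edges : deg L v < deg edges v
      less-than-edges = subst (_< deg edges v) (sym (deg-filter outside? edges v))
        (∑-mono-< (λ {e} _ → 𝟙-* (outside? e) (incident? v e) (incident? v e) λ _ i → i) (∈-allFin e)
          (subst₂ _<_ (sym (cong (_* 𝟙 (incident? v e)) (𝟙-no (outside? e) (λ e∉ → e∉ e∈))))
                      (sym (𝟙-yes (incident? v e) inc)) (s≤s z≤n)))

    -- An edge of `L` makes `μ` at least 1, and then `Δ` is at most `2 * r`.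
    deg≤ : ∀ v → deg L v ≤ 2 * r
    deg≤ v with deg L v in eq
    ... | zero  = z≤n
    ... | suc d with e , _ ← ∑-pos L (subst (1 ≤_) (sym eq) (s≤s z≤n)) =
      ℕ.≤-pred (subst (suc (suc d) ≤_) k≡′ (subst (_≤ Δ + μ) (ℕ.+-comm (suc d) 1)
        (ℕ.+-mono-≤ (subst (_≤ Δ) eq (ℕ.≤-trans (deg-filter-≤ outside? edges v) (deg≤Δ v))) (1≤μ e))))

  edgeColorable : EdgeColorable Σ (Δ + μ)
  edgeColorable with even-or-odd (Δ + μ)
  ... | r , inj₁ k≡ = subst (EdgeColorable Σ) (sym k≡) (colorable-even r k≡)
  ... | r , inj₂ k≡ = subst (EdgeColorable Σ) (sym k≡) (colorable-odd r k≡)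

theorem1p2 : (Σ : SignedMultigraph) → χ′ Σ ≤ SignedMultigraph.Δ Σ + SignedMultigraph.μ Σ
theorem1p2 Σ = proj₂ (proj₂ (chromaticIndex Σ)) _ (Vizing.edgeColorable Σ)
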